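{- Let $r,p,n$ be positive integers with $p \mid r$, let $\zeta$ be a primitive $r$-th root of unity, and let $w \in G(r,p,n)$. Write $\mathbf{RS}(w)=(\mathbf{P},\mathbf{Q})$ for its image under the generalized Robinson-Schensted map. Then for every $0 \le i \le r-1$, $$\mathrm{sgn}_i(w) = (-1)^{e(\mathbf{P})}\cdot (\zeta^i)^{\mathrm{spin}(\mathbf{P})+\mathrm{spin}(\mathbf{Q})}\cdot \mathrm{sign}(\mathbf{P})\cdot \mathrm{sign}(\mathbf{Q}),$$ where $e(\mathbf{P})$ is the total sum of the lengths of the even-indexed rows of the component tableaux of $\mathbf{P}$.
   Context: **Groups.** $G(r,p,n)$ is the subgroup of $GL_n(\mathbb{C})$ of matrices whose entries are $0$ or powers of $\zeta$, with exactly one non-zero entry in each row and column, and such that the $(r/p)$-th power of the product of all non-zero entries is $1$. Put $W_n = G(r,1,n)$, which contains $G(r,p,n)$. Write $[\zeta^{a_1}\sigma_1,\ldots,\zeta^{a_n}\sigma_n]$ (with $0\le a_i<r$) for the matrix whose non-zero entry in column $i$ is $\zeta^{a_i}$ and lies in row $\sigma_i$. The group $W_n$ is generated by $s_0=[\zeta\cdot 1,2,\ldots,n]$ and $s_j=[1,\ldots,j-1,j+1,j,j+2,\ldots,n]$ for $1\le j\le n-1$. **Sign representations.** For $0\le i\le r-1$, $\mathrm{sgn}_i$ is the one-dimensional representation of $W_n$ determined by $\mathrm{sgn}_i(s_0)=\zeta^i$ and $\mathrm{sgn}_i(s_j)=-1$ for $1\le j\le n-1$. It is a representation of $G(r,p,n)$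 by restriction. **Multitableaux.** A multipartition of rank $n$ is an $r$-tuple $\boldsymbol\lambda=(\lambda^0,\ldots,\lambda^{r-1})$ of (possibly empty) partitions whose ranks sum to $n$. A standard Young tableau of shape $\boldsymbol\lambda$ is a filling of the boxes of the $r$-tuple of Young diagrams of $\lambda^0,\ldots,\lambda^{r-1}$ with $1,\ldots,n$, each used exactly once, such that labels increase along rows and down columns within each component. **Generalized Robinson-Schensted map.** For $w=[\zeta^{a_1}\sigma_1,\ldots,\zeta^{a_n}\sigma_n]\in W_n$ and $0\le k<r$, let $w^{(k)}$ be the sequence of those $\sigma_i$ with $a_i=k$, in increasing order of $i$. Let $(P_k,Q_k)$ be the image of $w^{(k)}$ under the classical Robinson-Schensted (row insertion) map: $P_k$ is the insertion tableau, and $Q_k$ is the recording tableau in which the box added upon inserting $\sigma_i$ is labeled by its position $i$ in $w$. Then $\mathbf{P}(w)=(P_0,\ldots,P_{r-1})$, $\mathbf{Q}(w)=(Q_0,\ldots,Q_{r-1})$ and $\mathbf{RS}(w)=(\mathbf{P}(w),\mathbf{Q}(w))$. **Statistics.** For a tableau $T$, $\mathrm{Inv}(T)$ is the set of pairs $(i,j)$ of labels of $T$ with $j>i$ such that the box labeled $i$ is in a row strictly below the box labeled $j$. For a multitableau $\mathbf{T}=(T_0,\ldots,T_{r-1})$, $$\mathrm{Inv}(\mathbf{T})=\bigsqcup_k \mathrm{Inv}(T_k)\sqcup\bigsqcup_{k<l}\mathrm{Inv}(T_k,T_l),\qquad \mathrm{Inv}(T_k,T_l)=\{(j,i) : j>i,\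 j\text{ a label in }T_k,\ i\text{ a label in }T_l\}.$$ Put $\mathrm{inv}(\mathbf{T})=|\mathrm{Inv}(\mathbf{T})|$ and $\mathrm{sign}(\mathbf{T})=(-1)^{\mathrm{inv}(\mathbf{T})}$. For a tableau $T$, $e(T)$ is the number of boxes in rows of even index (rows numbered from $1$ at the top), and $e(\mathbf{T})=\sum_{k=0}^{r-1}e(T_k)$. Finally $\mathrm{spin}(\mathbf{T})=\frac12\sum_{k=0}^{r-1}k\cdot|\mathrm{sh}(T_k)|$, where $|\mathrm{sh}(T_k)|$ is the number of boxes of $T_k$. (Since $\mathbf{P}$ and $\mathbf{Q}$ have the same shape, $\mathrm{spin}(\mathbf{P})+\mathrm{spin}(\mathbf{Q})$ is an integer.) -}

module Defs where

open import Algebra.Apartness.Bundles using (HeytingCommutativeRing; HeytingField)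
open import Algebra.Bundles using (CommutativeRing)
open import Algebra.Bundles.Raw using (RawMonoid)
open import Algebra.Morphism.Structures using (module MonoidMorphisms)
import Algebra.Properties.CommutativeSemiring.Exp as Exp
import Algebra.Properties.Monoid.Sum as MonoidSum
open import Data.Bool.Base using (if_then_else_)
open import Data.Fin.Base as Fin using (Fin; zero; suc; toℕ)
import Data.Fin.Permutation as Perm
open import Data.Fin.Permutation using (Permutation′; _⟨$⟩ʳ_; _⟨$⟩ˡ_; transpose)
import Data.Fin.Properties as Fin
open import Data.Integer.Base using (+_)
open import Data.List.Base
  using (List; []; _∷_; _++_; map; concat; concatMap; length; filter; foldl; allFin; cartesianProduct)
open import Data.Maybe.Base using (Maybe; just; nothing)
open import Data.Nat.Base as ℕ using (ℕ; zero; suc; NonZero)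
open import Data.Nat.Divisibility using (_∣_)
open import Data.Nat.DivMod using (_/_; _mod_; n/1≡n; m/n*n≡m)
open import Data.Nat.ListAction using (sum)
import Data.Nat.Properties as ℕ
open import Data.Product.Base using (∃; _×_; _,_; proj₁; proj₂)
open import Data.Rational.Base as ℚ using (ℚ; ½)
open import Data.Sum.Base using (_⊎_; inj₁; inj₂)
open import Function.Base using (_∘_)
open import Level using (_⊔_)
open import Relation.Binary.PropositionalEquality.Core as ≡ using (_≡_; _≢_)
open import Relation.Nullary.Decidable using (yes; no; does; _×-dec_)
open import Relation.Nullary.Negation using (¬_; contradiction)

------------------------------------------------------------------------
-- Tableaux and the Robinson-Schensted map

-- A filling of a Young diagram, as the list of its rows from top to bottom.
Tableau : Set
Tableau = List (List ℕ)

Multitableau : ℕ → Set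
Multitableau r = Fin r → Tableau

-- `rowInsert x t` replaces the leftmost entry of t exceeding x by x and
-- returns the bumped entry; if there is none, x is appended to t.
rowInsert : ℕ → List ℕ → List ℕ × Maybe ℕ
rowInsert x []      = (x ∷ []) , nothing
rowInsert x (y ∷ t) with x ℕ.<? y
... | yes _ = (x ∷ t) , just y
... | no  _ = let (t′ , bumped) = rowInsert x t in (y ∷ t′) , bumped

-- The second component is the index, counted from 0, of the row that
-- has gained a box.
insert : ℕ → Tableau → Tableau × ℕ
insert x []      = ((x ∷ []) ∷ []) , 0
insert x (t ∷ T) with rowInsert x t
... | t′ , nothing = (t′ ∷ T) , 0
... | t′ , just y  = let (T′ , row) = insert y T in (t′ ∷ T′) , suc row

-- In the Robinson-Schensted map the row index never exceeds the number of
-- rows, so the last clause only ever sees `row = 0`.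
addBox : (row label : ℕ) → Tableau → Tableau
addBox zero      i (t ∷ T) = (t ++ (i ∷ [])) ∷ T
addBox (suc row) i (t ∷ T) = t ∷ addBox row i T
addBox _         i []      = (i ∷ []) ∷ []

rsStep : Tableau × Tableau → ℕ × ℕ → Tableau × Tableau
rsStep (P , Q) (i , x) = let (P′ , row) = insert x P in P′ , addBox row i Q

-- The argument is a word whose letters x come, as pairs (i , x), with the label
-- i of the box that the recording tableau gains when x is inserted.
robinsonSchensted : List (ℕ × ℕ) → Tableau × Tableau
robinsonSchensted = foldl rsStep ([] , [])

module _ {r n : ℕ} (a : Fin n → Fin r) (σ : Fin n → Fin n) where

  -- w⁽ᵏ⁾ for w = [ζ^a₁ σ₁ , … , ζ^aₙ σₙ], each letter paired with its position;
  -- elements of Fin n stand for 1 , … , n.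
  colourWord : Fin r → List (ℕ × ℕ)
  colourWord k = map (λ i → suc (toℕ i) , suc (toℕ (σ i)))
                     (filter (λ i → a i Fin.≟ k) (allFin n))

  windowRS : Multitableau r × Multitableau r
  windowRS = (proj₁ ∘ robinsonSchensted ∘ colourWord)
           , (proj₂ ∘ robinsonSchensted ∘ colourWord)

------------------------------------------------------------------------
-- Statistics

labels : Tableau → List ℕ
labels = concat

size : Tableau → ℕ
size T = length (labels T)

boxesFrom : ℕ → Tableau → List (ℕ × ℕ)
boxesFrom row []      = []
boxesFrom row (t ∷ T) = map (row ,_) t ++ boxesFrom (suc row) T

-- The pairs (row , label), rows being numbered from 1 at the top.
boxes : Tableau → List (ℕ × ℕ)
boxes = boxesFrom 1

-- Sets of inversions are given by duplicate-free enumerations, provided that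
-- the labels are distinct.
Inv : Tableau → List (ℕ × ℕ)
Inv T = map (λ ((_ , i) , (_ , j)) → i , j)
            (filter (λ ((rowᵢ , i) , (rowⱼ , j)) → (i ℕ.<? j) ×-dec (rowⱼ ℕ.<? rowᵢ))
                    (cartesianProduct (boxes T) (boxes T)))

Inv₂ : Tableau → Tableau → List (ℕ × ℕ)
Inv₂ Tₖ Tₗ = filter (λ (j , i) → i ℕ.<? j) (cartesianProduct (labels Tₖ) (labels Tₗ))

-- Number of boxes in rows of even index, the rows being numbered from 1.
evenBoxes : Tableau → ℕ
evenBoxes []           = 0
evenBoxes (_ ∷ [])     = 0
evenBoxes (_ ∷ t ∷ T)  = length t ℕ.+ evenBoxes T

module _ {r : ℕ} (𝐓 : Multitableau r) where

  𝐈nv : List (ℕ × ℕ)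
  𝐈nv = concatMap (λ k → Inv (𝐓 k)) (allFin r)
     ++ concatMap (λ (k , l) → Inv₂ (𝐓 k) (𝐓 l))
                  (filter (λ (k , l) → k Fin.<? l) (cartesianProduct (allFin r) (allFin r)))

  inv : ℕ
  inv = length 𝐈nv

  e : ℕ
  e = sum (map (λ k → evenBoxes (𝐓 k)) (allFin r))

  spin : ℚ
  spin = ½ ℚ.* (+ sum (map (λ k → toℕ k ℕ.* size (𝐓 k)) (allFin r)) ℚ./ 1)

------------------------------------------------------------------------
-- Roots of unity and the groups G(r,p,n)

-- The base field is an arbitrary (Heyting) field containing a primitive r-th
-- root of unity.
module _ {c ℓ₁ ℓ₂} (K : HeytingField c ℓ₁ ℓ₂) where
  open HeytingField K

  commutativeRing : CommutativeRing c ℓ₁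
  commutativeRing = HeytingCommutativeRing.commutativeRing heytingCommutativeRing

  open CommutativeRing commutativeRing using (commutativeSemiring)
  open Exp commutativeSemiring using (_^_)

  record IsPrimitiveRoot (r : ℕ) (ζ : Carrier) : Set ℓ₁ where
    field
      ζ^r≈1 : ζ ^ r ≈ 1#
      ζ^k≉1 : ∀ {k} → 0 ℕ.< k → k ℕ.< r → ¬ (ζ ^ k ≈ 1#)

module ReflectionGroup
  {c ℓ₁ ℓ₂} (K : HeytingField c ℓ₁ ℓ₂)
  (r : ℕ) .{{_ : NonZero r}}
  (ζ : HeytingField.Carrier K) (ζ-prim : IsPrimitiveRoot K r ζ)
  where

  open HeytingField K public
    using (Carrier; _≈_; _#_; _+_; _*_; -_; 0#; 1#)
  open HeytingField K hiding (Carrier; _≈_; _#_; _+_; _*_; -_; 0#; 1#; zero)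
  open IsPrimitiveRoot ζ-prim
  open CommutativeRing (commutativeRing K)
    using (commutativeSemiring; +-monoid; *-monoid; *-rawMonoid)
  open Exp commutativeSemiring using (^-cong; ^-congˡ; ^-congʳ; ^-homo-*; ^-assocʳ; ^-distrib-*)
  open Exp commutativeSemiring public using (_^_)
  open MonoidSum +-monoid using () renaming (sum to ∑)
  open MonoidSum *-monoid using () renaming (sum to ∏)
  open import Relation.Binary.Reasoning.Setoid setoid

  Matrix : ℕ → Set c
  Matrix n = Fin n → Fin n → Carrier

  infix  4 _≋_
  infixl 7 _·_

  _≋_ : ∀ {n} → Matrix n → Matrix n → Set ℓ₁
  A ≋ B = ∀ i j → A i j ≈ B i j

  _·_ : ∀ {n} → Matrix n → Matrix n → Matrix n
  (A · B) i j = ∑ λ k → A i k * B k j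

  -- The elements of G(r,p,n). The non-zero entries are the entries at
  -- (row j , j), one for each column j.
  record G (p n : ℕ) .{{_ : NonZero p}} : Set (c ⊔ ℓ₁ ⊔ ℓ₂) where
    field
      matrix     : Matrix n
      entry      : ∀ i j → matrix i j ≈ 0# ⊎ ∃ λ k → matrix i j ≈ ζ ^ k
      row        : Fin n → Fin n
      row-#0     : ∀ j → matrix (row j) j # 0#
      row-unique : ∀ {i j} → matrix i j # 0# → i ≡ row j
      col        : Fin n → Fin n
      col-#0     : ∀ i → matrix i (col i) # 0#
      col-unique : ∀ {i j} → matrix i j # 0# → j ≡ col i
      product    : ∏ (λ j → matrix (row j) j) ^ (r / p) ≈ 1#

    power : ∀ {i j} → matrix i j # 0# → ∃ λ k → matrix i j ≈ ζ ^ k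
    power {i} {j} nz with entry i j
    ... | inj₁ ≈0 = contradiction nz (#-irrefl ≈0)
    ... | inj₂ k  = k

    -- The element is [ζ^a₁ σ₁ , … , ζ^aₙ σₙ] with σⱼ = row j and aⱼ = colour j.
    colour : Fin n → Fin r
    colour j = proj₁ (power (row-#0 j)) mod r

  W : ℕ → Set (c ⊔ ℓ₁ ⊔ ℓ₂)
  W n = G 1 n

  1^ : ∀ m → 1# ^ m ≈ 1#
  1^ zero    = refl
  1^ (suc m) = trans (*-identityˡ _) (1^ m)

  G⊆W : ∀ {p n} .{{_ : NonZero p}} → p ∣ r → G p n → W n
  G⊆W {p} p∣r w = record
    { G w
    ; product = let x = ∏ (λ j → matrix (row j) j) in begin
        x ^ (r / 1)          ≈⟨ ^-congʳ x (n/1≡n r) ⟩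
        x ^ r                ≈⟨ ^-congʳ x (≡.sym (m/n*n≡m p∣r)) ⟩
        x ^ (r / p ℕ.* p)    ≈⟨ ^-assocʳ x (r / p) p ⟨
        (x ^ (r / p)) ^ p    ≈⟨ ^-congˡ p product ⟩
        1# ^ p               ≈⟨ 1^ p ⟩
        1#                   ∎
    }
    where
    open G w

  𝐑𝐒 : ∀ {n} → W n → Multitableau r × Multitableau r
  𝐑𝐒 w = windowRS (G.colour w) (G.row w)

  𝐏 𝐐 : ∀ {n} → W n → Multitableau r
  𝐏 w = proj₁ (𝐑𝐒 w)
  𝐐 w = proj₂ (𝐑𝐒 w)

  sign : Multitableau r → Carrier
  sign 𝐓 = (- 1#) ^ inv 𝐓

  [ζ^k]^r≈1 : ∀ k → (ζ ^ k) ^ r ≈ 1#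
  [ζ^k]^r≈1 k = begin
    (ζ ^ k) ^ r      ≈⟨ ^-assocʳ ζ k r ⟩
    ζ ^ (k ℕ.* r)    ≈⟨ ^-congʳ ζ (ℕ.*-comm k r) ⟩
    ζ ^ (r ℕ.* k)    ≈⟨ ^-assocʳ ζ r k ⟨
    (ζ ^ r) ^ k      ≈⟨ ^-congˡ k ζ^r≈1 ⟩
    1# ^ k           ≈⟨ 1^ k ⟩
    1#               ∎

  ≈power⇒#0 : ∀ {x} k → x ≈ ζ ^ k → x # 0#
  ≈power⇒#0 {x} k x≈ = invertible⇒# (x ^ ℕ.pred r , trans (*-comm _ _) x-0·x^ , x-0·x^)
    where
    x-0≈x : x + - 0# ≈ x
    x-0≈x = begin
      x + - 0#         ≈⟨ +-congˡ (trans (sym (+-identityˡ _)) (-‿inverseʳ 0#)) ⟩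
      x + 0#           ≈⟨ +-identityʳ x ⟩
      x                ∎
    x-0·x^ : (x + - 0#) * x ^ ℕ.pred r ≈ 1#
    x-0·x^ = begin
      (x + - 0#) * x ^ ℕ.pred r  ≈⟨ *-congʳ x-0≈x ⟩
      x ^ suc (ℕ.pred r)         ≈⟨ ^-cong x≈ (ℕ.suc-pred r) ⟩
      (ζ ^ k) ^ r                ≈⟨ [ζ^k]^r≈1 k ⟩
      1#                         ∎

  ∏^r≈1 : ∀ {n} (f : Fin n → Carrier) → (∀ j → ∃ λ k → f j ≈ ζ ^ k) → ∏ f ^ (r / 1) ≈ 1#
  ∏^r≈1 f ks = trans (^-congʳ _ (n/1≡n r)) (go f ks)
    where
    go : ∀ {n} (f : Fin n → Carrier) → (∀ j → ∃ λ k → f j ≈ ζ ^ k) → ∏ f ^ r ≈ 1#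
    go {zero}  f ks = 1^ r
    go {suc n} f ks = begin
      (f zero * ∏ (f ∘ suc)) ^ r       ≈⟨ ^-distrib-* _ _ r ⟩
      f zero ^ r * ∏ (f ∘ suc) ^ r     ≈⟨ *-cong (^-congˡ r (proj₂ (ks zero))) (go (f ∘ suc) (ks ∘ suc)) ⟩
      (ζ ^ proj₁ (ks zero)) ^ r * 1#   ≈⟨ *-identityʳ _ ⟩
      (ζ ^ proj₁ (ks zero)) ^ r        ≈⟨ [ζ^k]^r≈1 (proj₁ (ks zero)) ⟩
      1#                               ∎

  ∑≈0 : ∀ {n} (f : Fin n → Carrier) → (∀ k → f k ≈ 0#) → ∑ f ≈ 0#
  ∑≈0 {zero}  f ≈0 = refl
  ∑≈0 {suc n} f ≈0 = trans (+-cong (≈0 zero) (∑≈0 (f ∘ suc) (≈0 ∘ suc))) (+-identityˡ 0#)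

  ∑-single : ∀ {n} (f : Fin n → Carrier) k → (∀ k′ → k′ ≢ k → f k′ ≈ 0#) → ∑ f ≈ f k
  ∑-single f zero    ≈0 =
    trans (+-congˡ (∑≈0 (f ∘ suc) (λ k → ≈0 (suc k) λ ()))) (+-identityʳ _)
  ∑-single f (suc k) ≈0 =
    trans (+-cong (≈0 zero λ ())
                  (∑-single (f ∘ suc) k (λ k′ k′≢k → ≈0 (suc k′) (k′≢k ∘ Fin.suc-injective))))
          (+-identityˡ _)

  -- The matrix [ζ^a₁ σ₁ , … , ζ^aₙ σₙ].
  windowMatrix : ∀ {n} → (Fin n → ℕ) → Permutation′ n → Matrix n
  windowMatrix a σ i j = if does (i Fin.≟ (σ ⟨$⟩ʳ j)) then ζ ^ a j else 0#

  window : ∀ {n} → (Fin n → ℕ) → Permutation′ n → W n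
  window {n} a σ = record
    { matrix     = M
    ; entry      = entry
    ; row        = σ ⟨$⟩ʳ_
    ; row-#0     = λ j → ≈power⇒#0 (a j) (diag j)
    ; row-unique = unique
    ; col        = σ ⟨$⟩ˡ_
    ; col-#0     = λ i → ≡.subst (λ i′ → M i′ (σ ⟨$⟩ˡ i) # 0#) (Perm.inverseʳ σ)
                                 (≈power⇒#0 (a (σ ⟨$⟩ˡ i)) (diag (σ ⟨$⟩ˡ i)))
    ; col-unique = λ nz → ≡.trans (≡.sym (Perm.inverseˡ σ)) (≡.cong (σ ⟨$⟩ˡ_) (≡.sym (unique nz)))
    ; product    = ∏^r≈1 _ (λ j → a j , diag j)
    }
    where
    M : Matrix n
    M = windowMatrix a σ
    entry : ∀ i j → M i j ≈ 0# ⊎ ∃ λ k → M i j ≈ ζ ^ k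
    entry i j with i Fin.≟ (σ ⟨$⟩ʳ j)
    ... | yes _ = inj₂ (a j , refl)
    ... | no  _ = inj₁ refl
    diag : ∀ j → M (σ ⟨$⟩ʳ j) j ≈ ζ ^ a j
    diag j with (σ ⟨$⟩ʳ j) Fin.≟ (σ ⟨$⟩ʳ j)
    ... | yes _ = refl
    ... | no ≢  = contradiction ≡.refl ≢
    unique : ∀ {i j} → M i j # 0# → i ≡ σ ⟨$⟩ʳ j
    unique {i} {j} nz with i Fin.≟ (σ ⟨$⟩ʳ j)
    ... | yes ≡ = ≡
    ... | no  _ = contradiction nz (#-irrefl refl)

  infixl 7 _∙_

  _∙_ : ∀ {n} → W n → W n → W n
  _∙_ {n} A B = record
    { matrix     = C
    ; entry      = entry
    ; row        = λ j → A.row (B.row j)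
    ; row-#0     = λ j → let (k , C≈) = diag (A.row-#0 (B.row j)) (B.row-#0 j) in ≈power⇒#0 k C≈
    ; row-unique = λ nz → A.row-unique (proj₁ (factors nz))
    ; col        = λ i → B.col (A.col i)
    ; col-#0     = λ i → let (k , C≈) = diag (A.col-#0 i) (B.col-#0 (A.col i)) in ≈power⇒#0 k C≈
    ; col-unique = λ {i} nz → let (A# , B#) = factors nz in
        ≡.trans (B.col-unique B#) (≡.cong B.col (A.col-unique A#))
    ; product    = ∏^r≈1 _ (λ j → diag (A.row-#0 (B.row j)) (B.row-#0 j))
    }
    where
    module A = G A
    module B = G B
    C : Matrix n
    C = A.matrix · B.matrix
    C≈A*B : ∀ i j → C i j ≈ A.matrix i (B.row j) * B.matrix (B.row j) j
    C≈A*B i j = ∑-single _ (B.row j) vanish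
      where
      vanish : ∀ k → k ≢ B.row j → A.matrix i k * B.matrix k j ≈ 0#
      vanish k k≢ with B.entry k j
      ... | inj₁ ≈0       = trans (*-congˡ ≈0) (zeroʳ _)
      ... | inj₂ (m , ≈ζ) = contradiction (B.row-unique (≈power⇒#0 m ≈ζ)) k≢
    entry : ∀ i j → C i j ≈ 0# ⊎ ∃ λ k → C i j ≈ ζ ^ k
    entry i j with A.entry i (B.row j) | B.power (B.row-#0 j)
    ... | inj₁ ≈0        | _         = inj₁ (trans (C≈A*B i j) (trans (*-congʳ ≈0) (zeroˡ _)))
    ... | inj₂ (k , ≈ζᵏ) | (l , ≈ζˡ) =
      inj₂ (k ℕ.+ l , trans (C≈A*B i j) (trans (*-cong ≈ζᵏ ≈ζˡ) (sym (^-homo-* ζ k l))))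
    diag : ∀ {i k j} → A.matrix i k # 0# → B.matrix k j # 0# → ∃ λ m → C i j ≈ ζ ^ m
    diag {i} {k} {j} A# B# with B.row-unique B#
    ... | ≡.refl = let (a , ≈ζᵃ) = A.power A#; (b , ≈ζᵇ) = B.power B# in
      a ℕ.+ b , trans (C≈A*B i j) (trans (*-cong ≈ζᵃ ≈ζᵇ) (sym (^-homo-* ζ a b)))
    factors : ∀ {i j} → C i j # 0# → A.matrix i (B.row j) # 0# × B.matrix (B.row j) j # 0#
    factors {i} {j} nz with A.entry i (B.row j)
    ... | inj₁ ≈0       = contradiction nz (#-irrefl (trans (C≈A*B i j) (trans (*-congʳ ≈0) (zeroˡ _))))
    ... | inj₂ (k , ≈ζ) = ≈power⇒#0 k ≈ζ , B.row-#0 j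

  W-rawMonoid : ℕ → RawMonoid (c ⊔ ℓ₁ ⊔ ℓ₂) ℓ₁
  W-rawMonoid n = record
    { Carrier = W n
    ; _≈_     = λ A B → G.matrix A ≋ G.matrix B
    ; _∙_     = _∙_
    ; ε       = window (λ _ → 0) Perm.id
    }

  s₀ : ∀ {n} → W n
  s₀ = window (λ { zero → 1 ; (suc _) → 0 }) Perm.id

  -- The matrix of the transposition of positions j and j′; the generators
  -- s₁ , … , sₙ₋₁ are the `s j j′` for which j′ is the successor of j.
  s : ∀ {n} → Fin n → Fin n → W n
  s j j′ = window (λ _ → 0) (transpose j j′)

  -- φ is the one-dimensional representation sgnᵢ of Wₙ. A homomorphism from a
  -- group to the multiplicative monoid of K is the same thing as one to
  -- K× = GL₁(K).
  record IsSgn {n : ℕ} (i : Fin r) (φ : W n → Carrier) : Set (c ⊔ ℓ₁ ⊔ ℓ₂) where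
    open MonoidMorphisms (W-rawMonoid n) *-rawMonoid using (IsMonoidHomomorphism)
    field
      isMonoidHomomorphism : IsMonoidHomomorphism φ
      φ-s₀                 : φ s₀ ≈ ζ ^ toℕ i
      φ-s                  : ∀ j j′ → toℕ j′ ≡ suc (toℕ j) → φ (s j j′) ≈ - 1#

{-# OPTIONS --safe #-}

-- All signs are computed in ℤ/2, as parities of numbers of inversions of words.
--
-- On the representation side, sgnᵢ(w) is (ζⁱ)^(a₁ + ⋯ + aₙ) times the sign of σ:
-- w is the product of the permutation matrix of σ and a diagonal matrix, the
-- diagonal matrices with a single entry ζ are conjugate to s₀, and multiplication
-- by an adjacent transposition changes both sgnᵢ and the parity of inversions.
--
-- On the combinatorial side, a tableau with sorted rows has as many inversions as
-- its row reading word, top row first. Row insertion moves the inserted letter past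
-- the letters before the bumped one, and the bumped letter past the rest of the row.
-- Hence, when the new box appears in row ρ (from 0), the parity of the reading word
-- preceded by x changes by ρ plus the number of boxes outside the rows below ρ; these
-- two contributions are the changes in e(P) and, up to letters smaller than x being
-- counted instead of larger ones, in inv(Q). For the passage to several colours,
-- the inversions of positions plus those of values of a biword do not change parity
-- under rearrangement, so the letters of w may be grouped by colour.
module Submission where

open import Defs
open import Algebra.Apartness.Bundles using (HeytingField)
open import Algebra.Bundles using (CommutativeRing)
open import Algebra.Morphism.Structures using (module MonoidMorphisms)
import Algebra.Properties.CommutativeSemiring.Exp as Exp
import Algebra.Properties.Ring as RingProperties
open import Algebra.Solver.Ring.AlmostCommutativeRing using (fromCommutativeRing)
import Algebra.Solver.Ring.Simple as RingSolver
open import Data.Bool.Base using (Bool; true; false; _∧_; if_then_else_)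
open import Data.Bool.Properties using (∧-zeroʳ; ∧-identityʳ)
open import Data.Fin.Base as Fin using (Fin; zero; suc; toℕ; fromℕ<)
open import Data.Fin.Permutation as Perm
  using (Permutation′; permutation; _⟨$⟩ʳ_; _∘ₚ_; transpose; lift₀-transpose)
import Data.Fin.Permutation.Components as PC
open import Data.Fin.Permutation.Transposition.List using (eval; decompose; eval-decompose)
import Data.Fin.Properties as Fin
open import Data.List.Base
  using (List; []; _∷_; _++_; _∷ʳ_; map; concat; concatMap; length; filter; drop;
         allFin; tabulate; cartesianProduct)
open import Data.List.Membership.Propositional using (_∈_)
open import Data.List.Membership.Propositional.Properties using (∈-allFin)
open import Data.List.Properties
  using (length-map; length-++; map-∘; map-++; map-cong; map-cong-local; map-concatMap;
         map-tabulate; tabulate-cong; ++-assoc; ∷ʳ-++; foldl-∷ʳ; filter-accept; filter-reject)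
open import Data.List.Relation.Binary.Permutation.Propositional as ↭
  using (_↭_; ↭-refl; ↭-sym; ↭-trans; ↭-reflexive; ↭⇒↭ₛ)
open import Data.List.Relation.Binary.Permutation.Propositional.Properties
  using (All-resp-↭; ↭-length; map⁺; ++⁺ˡ; shift; ∷↭∷ʳ)
import Data.List.Relation.Binary.Permutation.Setoid.Properties as Permutationₛ
open import Data.List.Relation.Unary.All as All using (All; []; _∷_)
import Data.List.Relation.Unary.All.Properties as All
open import Data.List.Relation.Unary.AllPairs as AllPairs using (AllPairs; []; _∷_)
import Data.List.Relation.Unary.AllPairs.Properties as AllPairs
open import Data.List.Relation.Unary.Any using (here; there)
open import Data.List.Relation.Unary.Unique.Propositional using (Unique)
open import Data.List.Relation.Unary.Unique.Propositional.Properties using (allFin⁺)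
open import Data.List.Reverse using (Reverse; reverseView; []; _∶_∶ʳ_)
open import Data.Maybe.Base using (Maybe; just; nothing)
open import Data.Nat.Base as ℕ using (ℕ; zero; suc; _<_; _≤_; parity; NonZero)
open import Data.Nat.Divisibility using (_∣_)
open import Data.Nat.DivMod using (_%_; _/_; _mod_; m≡m%n+[m/n]*n; m%n<n)
open import Data.Nat.ListAction using (sum)
open import Data.Nat.ListAction.Properties using (sum-++; sum-↭)
import Data.Nat.Properties as ℕ
open import Data.Parity.Base as ℙ using (Parity; 0ℙ; 1ℙ; _+_)
import Data.Parity.Properties as ℙ
open import Data.Product.Base using (∃; _×_; _,_; proj₁; proj₂)
import Data.Rational.Base as ℚ
import Data.Rational.Properties as ℚ
open import Data.Sum.Base using (inj₁; inj₂)
open import Function.Base using (_∘_; id; flip; const)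
open import Function.Bundles using (module Injection)
open import Function.Definitions using (Injective)
open import Function.Properties.Inverse using (Inverse⇒Injection)
open import Level using (Level)
open import Relation.Binary.Core using (Rel)
open import Relation.Binary.Definitions using (tri<; tri≈; tri>)
open import Relation.Binary.PropositionalEquality
  using (_≡_; _≢_; _≗_; refl; sym; trans; cong; cong₂; subst; ≢-sym; setoid; module ≡-Reasoning)
import Relation.Binary.Reasoning.Setoid as SetoidReasoning
open import Relation.Nullary.Decidable using (yes; no; does; dec-true; dec-false)
open import Relation.Nullary.Negation using (contradiction)
open import Relation.Unary using (Pred; Decidable)

private
  variable
    α β ℓ : Level
    A : Set α
    B : Set β

-- The coefficients are themselves parities with decidable equality, so the solver knows
-- `1ℙ + 1ℙ ≡ 0ℙ` and cancels summands that occur twice.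
open RingSolver (fromCommutativeRing ℙ.+-*-commutativeRing) ℙ._≟_
  using (solve; _:=_; _:+_; con)

-- Sums of parities

∑ : List A → (A → Parity) → Parity
∑ []       f = 0ℙ
∑ (x ∷ xs) f = f x + ∑ xs f

∑-cong : ∀ (xs : List A) {f g : A → Parity} → f ≗ g → ∑ xs f ≡ ∑ xs g
∑-cong []       f≗g = refl
∑-cong (x ∷ xs) f≗g = cong₂ _+_ (f≗g x) (∑-cong xs f≗g)

∑-cong-local : ∀ {xs : List A} {f g} → All (λ x → f x ≡ g x) xs → ∑ xs f ≡ ∑ xs g
∑-cong-local []          = refl
∑-cong-local (fx≡gx ∷ p) = cong₂ _+_ fx≡gx (∑-cong-local p)

∑-zero : ∀ (xs : List A) → ∑ xs (const 0ℙ) ≡ 0ℙ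
∑-zero []       = refl
∑-zero (x ∷ xs) = ∑-zero xs

∑-++ : ∀ (xs ys : List A) f → ∑ (xs ++ ys) f ≡ ∑ xs f + ∑ ys f
∑-++ []       ys f = refl
∑-++ (x ∷ xs) ys f = trans (cong (f x +_) (∑-++ xs ys f)) (sym (ℙ.+-assoc (f x) _ _))

∑-+ : ∀ (xs : List A) f g → ∑ xs (λ x → f x + g x) ≡ ∑ xs f + ∑ xs g
∑-+ []       f g = refl
∑-+ (x ∷ xs) f g = trans (cong ((f x + g x) +_) (∑-+ xs f g))
  (solve 4 (λ p q r s → (p :+ q) :+ (r :+ s) := (p :+ r) :+ (q :+ s)) refl
     (f x) (g x) (∑ xs f) (∑ xs g))

∑-swap : ∀ (xs : List A) (ys : List B) f →
         ∑ xs (λ x → ∑ ys (f x)) ≡ ∑ ys (λ y → ∑ xs (flip f y))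
∑-swap []       ys f = sym (∑-zero ys)
∑-swap (x ∷ xs) ys f =
  trans (cong (∑ ys (f x) +_) (∑-swap xs ys f)) (sym (∑-+ ys (f x) _))

∑-map : ∀ (g : A → B) xs f → ∑ (map g xs) f ≡ ∑ xs (f ∘ g)
∑-map g []       f = refl
∑-map g (x ∷ xs) f = cong (f (g x) +_) (∑-map g xs f)

∑-↭ : ∀ {xs ys : List A} f → xs ↭ ys → ∑ xs f ≡ ∑ ys f
∑-↭ f ↭.refl         = refl
∑-↭ f (↭.prep x p)   = cong (f x +_) (∑-↭ f p)
∑-↭ f (↭.swap {ys = ys} x y p) = trans (cong (λ s → f x + (f y + s)) (∑-↭ f p))
  (solve 3 (λ p q r → p :+ (q :+ r) := q :+ (p :+ r)) refl (f x) (f y) (∑ ys f))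
∑-↭ f (↭.trans p q)  = trans (∑-↭ f p) (∑-↭ f q)

∑-cartesianProduct : ∀ (xs : List A) (ys : List B) f →
                     ∑ (cartesianProduct xs ys) f ≡ ∑ xs (λ x → ∑ ys (λ y → f (x , y)))
∑-cartesianProduct []       ys f = refl
∑-cartesianProduct (x ∷ xs) ys f =
  trans (∑-++ (map (x ,_) ys) _ f) (cong₂ _+_ (∑-map (x ,_) ys f) (∑-cartesianProduct xs ys f))

𝟙 : Bool → Parity
𝟙 false = 0ℙ
𝟙 true  = 1ℙ

∑-filter : ∀ {P : Pred A ℓ} (P? : Decidable P) xs f →
           ∑ (filter P? xs) f ≡ ∑ xs (λ x → 𝟙 (does (P? x)) ℙ.* f x)
∑-filter P? []       f = refl
∑-filter P? (x ∷ xs) f with does (P? x)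
... | true  = cong (f x +_) (∑-filter P? xs f)
... | false = ∑-filter P? xs f

∣_∣₂ : List A → Parity
∣ xs ∣₂ = ∑ xs (const 1ℙ)

parity-suc : ∀ n → parity (suc n) ≡ 1ℙ + parity n
parity-suc = ℙ.+-homo-+ 1

parity-length : ∀ (xs : List A) → parity (length xs) ≡ ∣ xs ∣₂
parity-length []       = refl
parity-length (x ∷ xs) = trans (parity-suc (length xs)) (cong (1ℙ +_) (parity-length xs))

parity-sum : ∀ (f : A → ℕ) xs → parity (sum (map f xs)) ≡ ∑ xs (parity ∘ f)
parity-sum f []       = refl
parity-sum f (x ∷ xs) =
  trans (ℙ.+-homo-+ (f x) _) (cong (parity (f x) +_) (parity-sum f xs))

∣filter∣ : ∀ {P : Pred A ℓ} (P? : Decidable P) xs →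
           parity (length (filter P? xs)) ≡ ∑ xs (𝟙 ∘ does ∘ P?)
∣filter∣ P? xs = trans (parity-length (filter P? xs))
  (trans (∑-filter P? xs (const 1ℙ)) (∑-cong xs λ x → ℙ.*-identityʳ _))

∣concatMap∣ : ∀ (f : A → List B) xs →
              parity (length (concatMap f xs)) ≡ ∑ xs (λ x → parity (length (f x)))
∣concatMap∣ f []       = refl
∣concatMap∣ f (x ∷ xs) = trans (cong parity (length-++ (f x)))
  (trans (ℙ.+-homo-+ (length (f x)) _) (cong (parity (length (f x)) +_) (∣concatMap∣ f xs)))

-- Inversions of words

-- Expressed through `y <? x` so that it agrees by computation with the tests filtered in `Inv` and
-- `Inv₂`.
_>₂_ : ℕ → ℕ → Parity
x >₂ y = 𝟙 (does (y ℕ.<? x))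

>⇒>₂ : ∀ {x y} → y < x → x >₂ y ≡ 1ℙ
>⇒>₂ {x} {y} y<x = cong 𝟙 (dec-true (y ℕ.<? x) y<x)

≤⇒>₂ : ∀ {x y} → x ≤ y → x >₂ y ≡ 0ℙ
≤⇒>₂ {x} {y} x≤y = cong 𝟙 (dec-false (y ℕ.<? x) (ℕ.≤⇒≯ x≤y))

>₂-flip : ∀ {x y} → x ≢ y → x >₂ y + y >₂ x ≡ 1ℙ
>₂-flip {x} {y} x≢y with ℕ.<-cmp x y
... | tri< x<y _ _ = cong₂ _+_ (≤⇒>₂ (ℕ.<⇒≤ x<y)) (>⇒>₂ x<y)
... | tri≈ _ x≡y _ = contradiction x≡y x≢y
... | tri> _ _ y<x = cong₂ _+_ (>⇒>₂ y<x) (≤⇒>₂ (ℕ.<⇒≤ y<x))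

-- The inversions of `xs ++ ys` with one letter in each factor. Unlike `inversions`, it depends on
-- the two words only up to rearrangement.
cross : List ℕ → List ℕ → Parity
cross xs ys = ∑ xs λ x → ∑ ys (x >₂_)

inversions : List ℕ → Parity
inversions []       = 0ℙ
inversions (x ∷ xs) = ∑ xs (x >₂_) + inversions xs

cross-↭ : ∀ {xs xs′ ys ys′} → xs ↭ xs′ → ys ↭ ys′ → cross xs ys ≡ cross xs′ ys′
cross-↭ {xs′ = xs′} {ys} xs↭ ys↭ =
  trans (∑-↭ (λ x → ∑ ys (x >₂_)) xs↭) (∑-cong xs′ λ x → ∑-↭ (x >₂_) ys↭)

inversions-++ : ∀ xs ys → inversions (xs ++ ys) ≡ inversions xs + (cross xs ys + inversions ys)
inversions-++ []       ys = refl
inversions-++ (x ∷ xs) ys = trans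
  (cong₂ _+_ (∑-++ xs ys (x >₂_)) (inversions-++ xs ys))
  (solve 5 (λ p q r s t → (p :+ q) :+ (r :+ (s :+ t)) := (p :+ r) :+ ((q :+ s) :+ t)) refl
     (∑ xs (x >₂_)) (∑ ys (x >₂_)) (inversions xs) (cross xs ys) (inversions ys))

>₂-all : ∀ {x ys} → All (_< x) ys → ∑ ys (x >₂_) ≡ ∣ ys ∣₂
>₂-all []           = refl
>₂-all (y<x ∷ ys<x) = cong₂ _+_ (>⇒>₂ y<x) (>₂-all ys<x)

>₂-none : ∀ {x ys} → All (x ≤_) ys → ∑ ys (x >₂_) ≡ 0ℙ
>₂-none []           = refl
>₂-none (x≤y ∷ x≤ys) = cong₂ _+_ (≤⇒>₂ x≤y) (>₂-none x≤ys)

inversions-sorted : ∀ {xs} → AllPairs _≤_ xs → inversions xs ≡ 0ℙ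
inversions-sorted []            = refl
inversions-sorted (x≤xs ∷ xs↗) = cong₂ _+_ (>₂-none x≤xs) (inversions-sorted xs↗)

-- Letters distinct from `x` are either smaller or larger. This converts the inversions of `x`
-- appended to a word into those of `x` put in front of it.
>₂-flips : ∀ {x ys} → All (x ≢_) ys → ∑ ys (x >₂_) + ∣ ys ∣₂ ≡ ∑ ys (_>₂ x)
>₂-flips []                              = refl
>₂-flips {x} {y ∷ ys} (x≢y ∷ x∉ys) = trans
  (cong (λ s → (x >₂ y + ∑ ys (x >₂_)) + (s + ∣ ys ∣₂)) (sym (>₂-flip x≢y)))
  (trans
    (solve 4 (λ p q r s → (p :+ r) :+ ((p :+ q) :+ s) := q :+ (r :+ s)) refl
      (x >₂ y) (y >₂ x) (∑ ys (x >₂_)) ∣ ys ∣₂)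
    (cong (y >₂ x +_) (>₂-flips x∉ys)))

inversions-snoc : ∀ xs x → inversions (xs ∷ʳ x) ≡ inversions xs + ∑ xs (_>₂ x)
inversions-snoc xs x = trans (inversions-++ xs (x ∷ []))
  (cong (inversions xs +_) (trans (ℙ.+-identityʳ _) (∑-cong xs λ y → ℙ.+-identityʳ (y >₂ x))))

-- Each letter of `ys` that `y` passes reverses the order of one pair of distinct letters, and so
-- changes the parity once.
inversions-move : ∀ xs {y} ys zs → All (y ≢_) ys →
                  inversions (xs ++ y ∷ ys ++ zs) + ∣ ys ∣₂ ≡ inversions (xs ++ ys ++ y ∷ zs)
inversions-move (x ∷ xs) {y} ys zs y∉ys = begin
  (∑ l (x >₂_) + inversions l) + ∣ ys ∣₂  ≡⟨ ℙ.+-assoc (∑ l (x >₂_)) _ _ ⟩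
  ∑ l (x >₂_) + (inversions l + ∣ ys ∣₂)
    ≡⟨ cong₂ _+_ (∑-↭ (x >₂_) (++⁺ˡ xs (↭-sym (shift y ys zs)))) (inversions-move xs ys zs y∉ys) ⟩
  inversions (x ∷ xs ++ ys ++ y ∷ zs)     ∎
  where
  open ≡-Reasoning
  l = xs ++ y ∷ ys ++ zs
inversions-move [] {y} []        zs []            = ℙ.+-identityʳ _
inversions-move [] {y} (z ∷ ys) zs (y≢z ∷ y∉ys) = begin
  (y >₂ z + ∑ l (y >₂_) + (∑ l (z >₂_) + inversions l)) + (1ℙ + ∣ ys ∣₂)
    -- The unit counting `z` is written as `y >₂ z + z >₂ y`, which cancels the pair in its old
    -- order and supplies it in the new one.
    ≡⟨ cong (λ s → (y >₂ z + ∑ l (y >₂_) + (∑ l (z >₂_) + inversions l)) + (s + ∣ ys ∣₂))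
            (sym (>₂-flip y≢z)) ⟩
  (y >₂ z + ∑ l (y >₂_) + (∑ l (z >₂_) + inversions l)) + ((y >₂ z + z >₂ y) + ∣ ys ∣₂)
    ≡⟨ solve 6 (λ p q r s t u → ((p :+ r) :+ (s :+ t)) :+ ((p :+ q) :+ u)
                              := (q :+ s) :+ ((r :+ t) :+ u)) refl
         (y >₂ z) (z >₂ y) (∑ l (y >₂_)) (∑ l (z >₂_)) (inversions l) ∣ ys ∣₂ ⟩
  ∑ (y ∷ l) (z >₂_) + (inversions (y ∷ l) + ∣ ys ∣₂)
    ≡⟨ cong₂ _+_ (∑-↭ (z >₂_) (↭-sym (shift y ys zs))) (inversions-move [] ys zs y∉ys) ⟩
  inversions (z ∷ ys ++ y ∷ zs) ∎
  where
  open ≡-Reasoning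
  l = ys ++ zs

-- A letter exceeding all others is inverted exactly with the letters after it. Each new label of
-- the recording tableau is of this kind.
inversions-insert-max : ∀ xs {y} ys → All (_< y) (xs ++ ys) →
                        inversions (xs ++ y ∷ ys) ≡ inversions (xs ++ ys) + ∣ ys ∣₂
inversions-insert-max []       ys <y = trans (cong (_+ inversions ys) (>₂-all <y)) (ℙ.+-comm ∣ ys ∣₂ _)
inversions-insert-max (x ∷ xs) {y} ys (x<y ∷ <y) = trans
  (cong₂ _+_ (trans (∑-↭ (x >₂_) (shift y xs ys)) (cong (_+ ∑ (xs ++ ys) (x >₂_)) (≤⇒>₂ (ℕ.<⇒≤ x<y))))
             (inversions-insert-max xs ys <y))
  (sym (ℙ.+-assoc (∑ (xs ++ ys) (x >₂_)) _ _))

Unique-resp-↭ : ∀ {xs ys : List A} → xs ↭ ys → Unique xs → Unique ys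
Unique-resp-↭ = Permutationₛ.Unique-resp-↭ (setoid _) ∘ ↭⇒↭ₛ

-- Swapping two neighbouring letters of a biword changes both summands.
inversions-biword : ∀ {xs ys : List (ℕ × ℕ)} → xs ↭ ys →
  Unique (map proj₁ xs) → Unique (map proj₂ xs) →
  inversions (map proj₁ xs) + inversions (map proj₂ xs) ≡
  inversions (map proj₁ ys) + inversions (map proj₂ ys)
inversions-biword ↭.refl _ _ = refl
inversions-biword (↭.prep {xs} {ys} (i , x) xs↭ys) (_ ∷ u₁) (_ ∷ u₂) = begin
  (∑ (map proj₁ xs) (i >₂_) + inversions (map proj₁ xs)) +
  (∑ (map proj₂ xs) (x >₂_) + inversions (map proj₂ xs))
    ≡⟨ interchange (∑ (map proj₁ xs) (i >₂_)) _ _ _ ⟩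
  (∑ (map proj₁ xs) (i >₂_) + ∑ (map proj₂ xs) (x >₂_)) +
  (inversions (map proj₁ xs) + inversions (map proj₂ xs))
    ≡⟨ cong₂ _+_ (cong₂ _+_ (∑-↭ (i >₂_) (map⁺ proj₁ xs↭ys)) (∑-↭ (x >₂_) (map⁺ proj₂ xs↭ys)))
                 (inversions-biword xs↭ys u₁ u₂) ⟩
  (∑ (map proj₁ ys) (i >₂_) + ∑ (map proj₂ ys) (x >₂_)) +
  (inversions (map proj₁ ys) + inversions (map proj₂ ys))
    ≡⟨ interchange (∑ (map proj₁ ys) (i >₂_)) _ _ _ ⟩
  (∑ (map proj₁ ys) (i >₂_) + inversions (map proj₁ ys)) +
  (∑ (map proj₂ ys) (x >₂_) + inversions (map proj₂ ys)) ∎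
  where
  open ≡-Reasoning
  interchange : ∀ p q r s → (p + q) + (r + s) ≡ (p + r) + (q + s)
  interchange = solve 4 (λ p q r s → (p :+ q) :+ (r :+ s) := (p :+ r) :+ (q :+ s)) refl
inversions-biword (↭.swap {xs} {ys} (i , x) (j , y) xs↭ys) ((i≢j ∷ _) ∷ _ ∷ u₁) ((x≢y ∷ _) ∷ _ ∷ u₂) =
  begin
  ((i >₂ j + p) + (q + r)) + ((x >₂ y + s) + (t + u))
    ≡⟨ solve 10 (λ a b c d p q r s t u →
         ((a :+ p) :+ (q :+ r)) :+ ((c :+ s) :+ (t :+ u)) :=
         ((a :+ b) :+ (c :+ d)) :+ (((b :+ q) :+ (d :+ t)) :+ ((p :+ s) :+ (r :+ u)))) refl
         (i >₂ j) (j >₂ i) (x >₂ y) (y >₂ x) p q r s t u ⟩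
  ((i >₂ j + j >₂ i) + (x >₂ y + y >₂ x)) + (((j >₂ i + q) + (y >₂ x + t)) + ((p + s) + (r + u)))
    ≡⟨ cong₂ _+_ (cong₂ _+_ (>₂-flip i≢j) (>₂-flip x≢y))
         (cong₂ _+_ (cong₂ _+_ (cong (j >₂ i +_) (∑-↭ (j >₂_) (map⁺ proj₁ xs↭ys)))
                               (cong (y >₂ x +_) (∑-↭ (y >₂_) (map⁺ proj₂ xs↭ys))))
                    (cong₂ _+_ (cong₂ _+_ (∑-↭ (i >₂_) (map⁺ proj₁ xs↭ys))
                                          (∑-↭ (x >₂_) (map⁺ proj₂ xs↭ys)))
                               (inversions-biword xs↭ys u₁ u₂))) ⟩
  ((j >₂ i + q′) + (y >₂ x + t′)) + ((p′ + s′) + (r′ + u′))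
    ≡⟨ solve 8 (λ b d p q r s t u →
         ((b :+ q) :+ (d :+ t)) :+ ((p :+ s) :+ (r :+ u)) :=
         ((b :+ q) :+ (p :+ r)) :+ ((d :+ t) :+ (s :+ u))) refl
         (j >₂ i) (y >₂ x) p′ q′ r′ s′ t′ u′ ⟩
  ((j >₂ i + q′) + (p′ + r′)) + ((y >₂ x + t′) + (s′ + u′)) ∎
  where
  open ≡-Reasoning
  p = ∑ (map proj₁ xs) (i >₂_)
  q = ∑ (map proj₁ xs) (j >₂_)
  r = inversions (map proj₁ xs)
  s = ∑ (map proj₂ xs) (x >₂_)
  t = ∑ (map proj₂ xs) (y >₂_)
  u = inversions (map proj₂ xs)
  p′ = ∑ (map proj₁ ys) (i >₂_)
  q′ = ∑ (map proj₁ ys) (j >₂_)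
  r′ = inversions (map proj₁ ys)
  s′ = ∑ (map proj₂ ys) (x >₂_)
  t′ = ∑ (map proj₂ ys) (y >₂_)
  u′ = inversions (map proj₂ ys)
inversions-biword (↭.trans xs↭ys ys↭zs) u₁ u₂ = trans
  (inversions-biword xs↭ys u₁ u₂)
  (inversions-biword ys↭zs (Unique-resp-↭ (map⁺ proj₁ xs↭ys) u₁)
                           (Unique-resp-↭ (map⁺ proj₂ xs↭ys) u₂))

AllPairs-++⁻ : ∀ {R : Rel A ℓ} xs {ys} → AllPairs R (xs ++ ys) →
               AllPairs R xs × AllPairs R ys × All (λ x → All (R x) ys) xs
AllPairs-++⁻ []       rs        = [] , rs , []
AllPairs-++⁻ (x ∷ xs) (r ∷ rs) =
  let (rxs , rys , rxys) = AllPairs-++⁻ xs rs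
      (r₁ , r₂)          = All.++⁻ xs r
  in r₁ ∷ rxs , rys , r₂ ∷ rxys

-- Row insertion

-- The graph of `rowInsert`. Matching on it makes the cut of the row explicit, both before and after
-- the insertion.
data RowInsertion (x : ℕ) : List ℕ → List ℕ × Maybe ℕ → Set where
  append : ∀ {t} → All (_≤ x) t → RowInsertion x t (t ∷ʳ x , nothing)
  bump   : ∀ {y} t {u} → All (_≤ x) t → x < y →
           RowInsertion x (t ++ y ∷ u) (t ++ x ∷ u , just y)

rowInsertion : ∀ x t → RowInsertion x t (rowInsert x t)
rowInsertion x []      = append []
rowInsertion x (y ∷ t) with x ℕ.<? y
... | yes x<y = bump [] [] x<y
... | no  x≮y with rowInsert x t | rowInsertion x t
...   | _ | append t≤x     = append (ℕ.≮⇒≥ x≮y ∷ t≤x)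
...   | _ | bump t t≤x x<z = bump (y ∷ t) (ℕ.≮⇒≥ x≮y ∷ t≤x) x<z

module _ (x y : ℕ) (t u v : List ℕ) where

  open ≡-Reasoning

  private
    assoc : ∀ z → (t ++ z ∷ u) ++ v ≡ t ++ z ∷ u ++ v
    assoc z = ++-assoc t (z ∷ u) v

    assoc′ : (t ++ x ∷ u) ++ y ∷ v ≡ (t ∷ʳ x) ++ u ++ y ∷ v
    assoc′ = trans (++-assoc t (x ∷ u) (y ∷ v)) (sym (++-assoc t (x ∷ []) (u ++ y ∷ v)))

  bump-↭ : x ∷ (t ++ y ∷ u) ++ v ↭ (t ++ x ∷ u) ++ y ∷ v
  bump-↭ = ↭-trans (↭-reflexive (cong (x ∷_) (assoc y)))
    (↭-trans (↭-sym (shift x t (y ∷ u ++ v)))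
    (↭-trans (++⁺ˡ t (↭.prep x (↭-sym (shift y u v))))
             (↭-reflexive (sym (++-assoc t (x ∷ u) (y ∷ v))))))

  -- Two moves: `x` passes `t` to reach the place just before `y`, then `y` passes `u` and arrives
  -- in front of the lower rows `v`, ready to be inserted there.
  bump-inversions : All (x ≢_) t → All (y ≢_) u →
    inversions (x ∷ (t ++ y ∷ u) ++ v) + (∣ t ∣₂ + ∣ u ∣₂) ≡ inversions ((t ++ x ∷ u) ++ y ∷ v)
  bump-inversions x∉t y∉u = begin
    inversions (x ∷ (t ++ y ∷ u) ++ v) + (∣ t ∣₂ + ∣ u ∣₂)
      ≡⟨ cong (λ w → inversions (x ∷ w) + (∣ t ∣₂ + ∣ u ∣₂)) (assoc y) ⟩
    inversions (x ∷ t ++ y ∷ u ++ v) + (∣ t ∣₂ + ∣ u ∣₂)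
      ≡⟨ ℙ.+-assoc (inversions (x ∷ t ++ y ∷ u ++ v)) _ _ ⟨
    inversions (x ∷ t ++ y ∷ u ++ v) + ∣ t ∣₂ + ∣ u ∣₂
      ≡⟨ cong (_+ ∣ u ∣₂) (inversions-move [] t (y ∷ u ++ v) x∉t) ⟩
    inversions (t ++ x ∷ y ∷ u ++ v) + ∣ u ∣₂
      ≡⟨ cong (λ w → inversions w + ∣ u ∣₂) (++-assoc t (x ∷ []) (y ∷ u ++ v)) ⟨
    inversions ((t ∷ʳ x) ++ y ∷ u ++ v) + ∣ u ∣₂
      ≡⟨ inversions-move (t ∷ʳ x) u v y∉u ⟩
    inversions ((t ∷ʳ x) ++ u ++ y ∷ v)
      ≡⟨ cong inversions assoc′ ⟨
    inversions ((t ++ x ∷ u) ++ y ∷ v) ∎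

insert-↭ : ∀ x T → x ∷ concat T ↭ concat (proj₁ (insert x T))
insert-↭ x []      = ↭-refl
insert-↭ x (t ∷ T) with rowInsert x t | rowInsertion x t
... | _ | append _           =
  ↭-trans (↭-sym (shift x t (concat T))) (↭-reflexive (sym (∷ʳ-++ t x (concat T))))
... | _ | bump {y} t {u} _ _ =
  ↭-trans (bump-↭ x y t u (concat T)) (++⁺ˡ (t ++ x ∷ u) (insert-↭ y T))

-- Shapes

shape : Tableau → List ℕ
shape = map length

-- The boxes strictly below the row of index `row`, counted from 0. It is computed from the shape
-- alone so that it can be carried over from `P` to `Q`.
below : ℕ → List ℕ → Parity
below row λs = parity (sum (drop (suc row) λs))

-- The common effect of `insert` and `addBox` on shapes; the last clause starts a new row whatever
-- the index, as that of `addBox` does.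
grow : ℕ → List ℕ → List ℕ
grow zero      (l ∷ λs) = suc l ∷ λs
grow (suc row) (l ∷ λs) = l ∷ grow row λs
grow _         []       = 1 ∷ []

length-∷ʳ : ∀ (xs : List A) x → length (xs ∷ʳ x) ≡ suc (length xs)
length-∷ʳ xs x = ↭-length (↭-sym (∷↭∷ʳ x xs))

length-replace : ∀ (t {u} : List A) {x y} → length (t ++ x ∷ u) ≡ length (t ++ y ∷ u)
length-replace []      = refl
length-replace (_ ∷ t) = cong suc (length-replace t)

∣concat∣ : ∀ T → ∣ concat T ∣₂ ≡ parity (sum (shape T))
∣concat∣ []      = refl
∣concat∣ (t ∷ T) = trans (∑-++ t (concat T) _)
  (trans (cong₂ _+_ (sym (parity-length t)) (∣concat∣ T)) (sym (ℙ.+-homo-+ (length t) _)))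

shape-insert : ∀ x T → let (T′ , row) = insert x T in shape T′ ≡ grow row (shape T)
shape-insert x []      = refl
shape-insert x (t ∷ T) with rowInsert x t | rowInsertion x t
... | _ | append _       = cong (_∷ shape T) (length-∷ʳ t x)
... | _ | bump {y} t _ _ = cong₂ _∷_ (length-replace t) (shape-insert y T)

shape-addBox : ∀ row i T → shape (addBox row i T) ≡ grow row (shape T)
shape-addBox zero      i []      = refl
shape-addBox (suc row) i []      = refl
shape-addBox zero      i (t ∷ T) = cong (_∷ shape T) (length-∷ʳ t i)
shape-addBox (suc row) i (t ∷ T) = cong (length t ∷_) (shape-addBox row i T)

-- A new top row exchanges the even and odd rows of `T`, and modulo 2 the boxes in odd rows are all
-- the boxes plus those in even rows.
evenBoxes-∷ : ∀ t T → parity (evenBoxes (t ∷ T)) ≡ ∣ concat T ∣₂ + parity (evenBoxes T)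
evenBoxes-∷ t []      = refl
evenBoxes-∷ t (u ∷ T) = begin
  parity (length u ℕ.+ evenBoxes T)        ≡⟨ ℙ.+-homo-+ (length u) _ ⟩
  parity (length u) + parity (evenBoxes T) ≡⟨ cong (_+ parity (evenBoxes T)) (parity-length u) ⟩
  ∣ u ∣₂ + parity (evenBoxes T)
    ≡⟨ solve 3 (λ p q r → p :+ r := (p :+ q) :+ (q :+ r)) refl ∣ u ∣₂ ∣ concat T ∣₂ _ ⟩
  (∣ u ∣₂ + ∣ concat T ∣₂) + (∣ concat T ∣₂ + parity (evenBoxes T))
    ≡⟨ cong₂ _+_ (sym (∑-++ u (concat T) _)) (sym (evenBoxes-∷ u T)) ⟩
  ∣ u ++ concat T ∣₂ + parity (evenBoxes (u ∷ T)) ∎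
  where open ≡-Reasoning

-- Since `row` counts from 0 and the rows of `evenBoxes` from 1, the new box is in an even row
-- exactly when `row` is odd.
evenBoxes-insert : ∀ x T → let (T′ , row) = insert x T in
                   parity (evenBoxes T′) ≡ parity (evenBoxes T) + parity row
evenBoxes-insert x []      = refl
evenBoxes-insert x (t ∷ T) with rowInsert x t | rowInsertion x t
... | _ | append _           = trans (evenBoxes-∷ _ T)
  (trans (sym (evenBoxes-∷ t T)) (sym (ℙ.+-identityʳ _)))
... | _ | bump {y} t {u} _ _ = let (T′ , row) = insert y T in begin
  parity (evenBoxes ((t ++ x ∷ u) ∷ T′))
    ≡⟨ evenBoxes-∷ _ T′ ⟩
  ∣ concat T′ ∣₂ + parity (evenBoxes T′)
    ≡⟨ cong₂ _+_ (∑-↭ _ (↭-sym (insert-↭ y T))) (evenBoxes-insert y T) ⟩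
  (1ℙ + ∣ concat T ∣₂) + (parity (evenBoxes T) + parity row)
    ≡⟨ solve 3 (λ p q r → (con 1ℙ :+ p) :+ (q :+ r) := (p :+ q) :+ (con 1ℙ :+ r)) refl
         ∣ concat T ∣₂ _ (parity row) ⟩
  (∣ concat T ∣₂ + parity (evenBoxes T)) + (1ℙ + parity row)
    ≡⟨ cong₂ _+_ (sym (evenBoxes-∷ (t ++ y ∷ u) T)) (sym (parity-suc row)) ⟩
  parity (evenBoxes ((t ++ y ∷ u) ∷ T)) + parity (suc row) ∎
  where open ≡-Reasoning

-- Inversions of tableaux

-- In a row that bumps, the letters passed are all but the bumped one; against the boxes of that row
-- in the size of the tableau they leave one unit, and these units add up to `parity row`. In the
-- last row all letters are passed, which leaves only the boxes below it.
insert-inversions : ∀ x T → Unique (x ∷ concat T) → let (T′ , row) = insert x T in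
  inversions (x ∷ concat T) + ∣ concat T ∣₂ ≡
  inversions (concat T′) + (parity row + below row (shape T))
insert-inversions x []      _ = refl
insert-inversions x (t ∷ T) (x∉ ∷ u) with rowInsert x t | rowInsertion x t
... | _ | append _ = begin
  inversions (x ∷ t ++ concat T) + ∣ t ++ concat T ∣₂
    ≡⟨ cong (inversions (x ∷ t ++ concat T) +_) (∑-++ t (concat T) _) ⟩
  inversions (x ∷ t ++ concat T) + (∣ t ∣₂ + ∣ concat T ∣₂)
    ≡⟨ ℙ.+-assoc (inversions (x ∷ t ++ concat T)) _ _ ⟨
  inversions (x ∷ t ++ concat T) + ∣ t ∣₂ + ∣ concat T ∣₂
    ≡⟨ cong₂ _+_ (inversions-move [] t (concat T) (All.++⁻ˡ t x∉)) (∣concat∣ T) ⟩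
  inversions (t ++ x ∷ concat T) + below 0 (shape (t ∷ T))
    ≡⟨ cong (λ w → inversions w + below 0 (shape (t ∷ T))) (∷ʳ-++ t x (concat T)) ⟨
  inversions (concat (t ∷ʳ x ∷ T)) + below 0 (shape (t ∷ T)) ∎
  where open ≡-Reasoning
... | _ | bump {y} t {s} _ _ = let (T′ , row) = insert y T in begin
  inversions (x ∷ (t ++ y ∷ s) ++ concat T) + ∣ (t ++ y ∷ s) ++ concat T ∣₂
    ≡⟨ cong (inversions (x ∷ (t ++ y ∷ s) ++ concat T) +_)
         (trans (∑-++ (t ++ y ∷ s) (concat T) _) (cong (_+ ∣ concat T ∣₂) (∑-++ t (y ∷ s) _))) ⟩
  inversions (x ∷ (t ++ y ∷ s) ++ concat T) + ((∣ t ∣₂ + (1ℙ + ∣ s ∣₂)) + ∣ concat T ∣₂)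
    ≡⟨ solve 4 (λ p q r s → p :+ ((q :+ (con 1ℙ :+ r)) :+ s) := (p :+ (q :+ r)) :+ (con 1ℙ :+ s)) refl
         (inversions (x ∷ (t ++ y ∷ s) ++ concat T)) ∣ t ∣₂ ∣ s ∣₂ ∣ concat T ∣₂ ⟩
  (inversions (x ∷ (t ++ y ∷ s) ++ concat T) + (∣ t ∣₂ + ∣ s ∣₂)) + (1ℙ + ∣ concat T ∣₂)
    ≡⟨ cong (_+ (1ℙ + ∣ concat T ∣₂)) (trans
         (bump-inversions x y t s (concat T) (All.++⁻ˡ t (All.++⁻ˡ (t ++ y ∷ s) x∉)) y∉s)
         (inversions-++ (t ++ x ∷ s) (y ∷ concat T))) ⟩
  (inversions (t ++ x ∷ s) + (cross (t ++ x ∷ s) (y ∷ concat T) + inversions (y ∷ concat T)))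
    + (1ℙ + ∣ concat T ∣₂)
    ≡⟨ solve 4 (λ p q r s → (p :+ (q :+ r)) :+ (con 1ℙ :+ s) := (p :+ q) :+ (con 1ℙ :+ (r :+ s))) refl
         (inversions (t ++ x ∷ s)) (cross (t ++ x ∷ s) (y ∷ concat T)) (inversions (y ∷ concat T)) ∣ concat T ∣₂ ⟩
  (inversions (t ++ x ∷ s) + cross (t ++ x ∷ s) (y ∷ concat T))
    + (1ℙ + (inversions (y ∷ concat T) + ∣ concat T ∣₂))
    -- The pairs between the new row and the rest are unaffected by rearranging the rest; what
    -- remains is the induction hypothesis for the bumped letter.
    ≡⟨ cong₂ (λ p q → (inversions (t ++ x ∷ s) + p) + (1ℙ + q))
         (cross-↭ {t ++ x ∷ s} ↭-refl (insert-↭ y T)) (insert-inversions y T y∷T!) ⟩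
  (inversions (t ++ x ∷ s) + cross (t ++ x ∷ s) (concat T′))
    + (1ℙ + (inversions (concat T′) + (parity row + below row (shape T))))
    ≡⟨ solve 5 (λ p q r s t → (p :+ q) :+ (con 1ℙ :+ (r :+ (s :+ t))) :=
                              (p :+ (q :+ r)) :+ ((con 1ℙ :+ s) :+ t)) refl
         (inversions (t ++ x ∷ s)) (cross (t ++ x ∷ s) (concat T′)) (inversions (concat T′))
         (parity row) (below row (shape T)) ⟩
  (inversions (t ++ x ∷ s) + (cross (t ++ x ∷ s) (concat T′) + inversions (concat T′)))
    + ((1ℙ + parity row) + below row (shape T))
    ≡⟨ cong₂ (λ p q → p + (q + below row (shape T)))
         (sym (inversions-++ (t ++ x ∷ s) (concat T′))) (sym (parity-suc row)) ⟩
  inversions ((t ++ x ∷ s) ++ concat T′) + (parity (suc row) + below row (shape T)) ∎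
  where
  open ≡-Reasoning
  -- Read off from the rearranged word, in which `y` already stands directly before the lower rows.
  y∷T! : Unique (y ∷ concat T)
  y∷T! = proj₁ (proj₂ (AllPairs-++⁻ (t ++ x ∷ s)
           (Unique-resp-↭ (bump-↭ x y t s (concat T)) (x∉ ∷ u))))
  y∉s : All (y ≢_) s
  y∉s = AllPairs.head (proj₁ (proj₂ (AllPairs-++⁻ t (proj₁ (AllPairs-++⁻ (t ++ y ∷ s) u)))))

-- Presents the new reading word as the old one with `i` put in at a cut; the letters after the cut
-- are those of the lower rows.
addBox-split : ∀ row i T → ∃ λ xs → ∃ λ ys →
  concat T ≡ xs ++ ys × concat (addBox row i T) ≡ xs ++ i ∷ ys × ∣ ys ∣₂ ≡ below row (shape T)
addBox-split zero      i []      = [] , [] , refl , refl , refl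
addBox-split (suc row) i []      = [] , [] , refl , refl , refl
addBox-split zero      i (t ∷ T) = t , concat T , refl , ∷ʳ-++ t i (concat T) , ∣concat∣ T
addBox-split (suc row) i (t ∷ T) =
  let (xs , ys , T≡ , T′≡ , ∣ys∣) = addBox-split row i T in
  t ++ xs , ys , trans (cong (t ++_) T≡) (sym (++-assoc t xs ys))
               , trans (cong (t ++_) T′≡) (sym (++-assoc t xs (i ∷ ys))) , ∣ys∣

addBox-↭ : ∀ row i T → i ∷ concat T ↭ concat (addBox row i T)
addBox-↭ row i T = let (xs , ys , T≡ , T′≡ , _) = addBox-split row i T in
  ↭-trans (↭-reflexive (cong (i ∷_) T≡)) (↭-trans (↭-sym (shift i xs ys)) (↭-reflexive (sym T′≡)))

addBox-inversions : ∀ row i T → All (_< i) (concat T) →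
  inversions (concat (addBox row i T)) ≡ inversions (concat T) + below row (shape T)
addBox-inversions row i T <i = let (xs , ys , T≡ , T′≡ , ∣ys∣) = addBox-split row i T in
  trans (cong inversions T′≡)
  (trans (inversions-insert-max xs ys (subst (All (_< i)) T≡ <i))
         (cong₂ _+_ (cong inversions (sym T≡)) ∣ys∣))

-- Sorted rows and the invariant of the Robinson-Schensted map

RowsSorted : Tableau → Set
RowsSorted = All (AllPairs _≤_)

∷ʳ-sorted : ∀ {t x} → AllPairs _≤_ t → All (_≤ x) t → AllPairs _≤_ (t ∷ʳ x)
∷ʳ-sorted t↗ t≤x = AllPairs.++⁺ t↗ ([] ∷ []) (All.map (_∷ []) t≤x)

insert-sorted : ∀ x T → RowsSorted T → RowsSorted (proj₁ (insert x T))
insert-sorted x []      _           = ([] ∷ []) ∷ []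
insert-sorted x (t ∷ T) (t↗ ∷ T↗) with rowInsert x t | rowInsertion x t
... | _ | append t≤x           = ∷ʳ-sorted t↗ t≤x ∷ T↗
... | _ | bump {y} t {u} t≤x x<y with AllPairs-++⁻ t t↗
...   | t↗ , y≤u ∷ u↗ , t≤yu =
  AllPairs.++⁺ t↗ (All.map (ℕ.≤-trans (ℕ.<⇒≤ x<y)) y≤u ∷ u↗)
               (All.zipWith (λ (z≤x , z≤yu) → z≤x ∷ All.tail z≤yu) (t≤x , t≤yu))
  ∷ insert-sorted y T T↗

addBox-sorted : ∀ row i T → All (_< i) (concat T) → RowsSorted T → RowsSorted (addBox row i T)
addBox-sorted zero      i []      _  _           = ([] ∷ []) ∷ []
addBox-sorted (suc row) i []      _  _           = ([] ∷ []) ∷ []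
addBox-sorted zero      i (t ∷ T) <i (t↗ ∷ T↗) =
  ∷ʳ-sorted t↗ (All.map ℕ.<⇒≤ (All.++⁻ˡ t <i)) ∷ T↗
addBox-sorted (suc row) i (t ∷ T) <i (t↗ ∷ T↗) = t↗ ∷ addBox-sorted row i T (All.++⁻ʳ t <i) T↗

-- Holds after every prefix `w` of a colour word. The field `sign` is the identity for a single
-- colour; the label fields move sums over `w` to the tableaux, and `sameShape` lets the growth of
-- `Q` be measured on `P`.
record RSInvariant (w : List (ℕ × ℕ)) (PQ : Tableau × Tableau) : Set where
  P = proj₁ PQ
  Q = proj₂ PQ
  field
    P-labels  : map proj₂ w ↭ concat P
    Q-labels  : map proj₁ w ↭ concat Q
    P-sorted  : RowsSorted P
    Q-sorted  : RowsSorted Q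
    sameShape : shape P ≡ shape Q
    sign      : inversions (map proj₂ w) ≡
                parity (evenBoxes P) + (inversions (concat P) + inversions (concat Q))

rsStep-invariant : ∀ {w PQ} i x → All (_< i) (map proj₁ w) → Unique (x ∷ map proj₂ w) →
                   RSInvariant w PQ → RSInvariant (w ∷ʳ (i , x)) (rsStep PQ (i , x))
rsStep-invariant {w} {P , Q} i x <i x∷w! I = record
  { P-labels  = ↭-trans (snoc-↭ proj₂ P-labels) (insert-↭ x P)
  ; Q-labels  = ↭-trans (snoc-↭ proj₁ Q-labels) (addBox-↭ row i Q)
  ; P-sorted  = insert-sorted x P P-sorted
  ; Q-sorted  = addBox-sorted row i Q Q<i Q-sorted
  ; sameShape = trans (shape-insert x P)
                (trans (cong (grow row) sameShape) (sym (shape-addBox row i Q)))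
  ; sign      = begin
      inversions (map proj₂ (w ∷ʳ (i , x)))
        ≡⟨ cong inversions (map-++ proj₂ w _) ⟩
      inversions (map proj₂ w ∷ʳ x)
        ≡⟨ inversions-snoc (map proj₂ w) x ⟩
      inversions (map proj₂ w) + ∑ (map proj₂ w) (_>₂ x)
        -- The earlier letters larger than `x` are counted on `P` and traded for the smaller ones
        -- plus the size of `P`, as if `x` were put in front of its reading word.
        ≡⟨ cong₂ _+_ sign (trans (∑-↭ (_>₂ x) P-labels) (sym (>₂-flips (AllPairs.head x∷P!)))) ⟩
      (parity (evenBoxes P) + (inversions (concat P) + inversions (concat Q)))
        + (∑ (concat P) (x >₂_) + ∣ concat P ∣₂)
        ≡⟨ solve 5 (λ e p q s l → (e :+ (p :+ q)) :+ (s :+ l) := (e :+ q) :+ ((s :+ p) :+ l)) refl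
             (parity (evenBoxes P)) (inversions (concat P)) (inversions (concat Q))
             (∑ (concat P) (x >₂_)) ∣ concat P ∣₂ ⟩
      (parity (evenBoxes P) + inversions (concat Q)) + (inversions (x ∷ concat P) + ∣ concat P ∣₂)
        ≡⟨ cong ((parity (evenBoxes P) + inversions (concat Q)) +_) (insert-inversions x P x∷P!) ⟩
      (parity (evenBoxes P) + inversions (concat Q))
        + (inversions (concat P′) + (parity row + below row (shape P)))
        ≡⟨ solve 5 (λ e q p r b → (e :+ q) :+ (p :+ (r :+ b)) := (e :+ r) :+ (p :+ (q :+ b))) refl
             (parity (evenBoxes P)) (inversions (concat Q)) (inversions (concat P′))
             (parity row) (below row (shape P)) ⟩
      (parity (evenBoxes P) + parity row)
        + (inversions (concat P′) + (inversions (concat Q) + below row (shape P)))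
        -- The two contributions separate: `parity row` is the change of `evenBoxes`, and
        -- `below row` that of the inversions of `Q`.
        ≡⟨ cong₂ (λ e q → e + (inversions (concat P′) + q)) (sym (evenBoxes-insert x P))
             (trans (cong (λ λs → inversions (concat Q) + below row λs) sameShape)
                    (sym (addBox-inversions row i Q Q<i))) ⟩
      parity (evenBoxes P′) + (inversions (concat P′) + inversions (concat (addBox row i Q))) ∎
  }
  where
  open ≡-Reasoning
  open RSInvariant I hiding (P; Q)
  P′ = proj₁ (insert x P)
  row = proj₂ (insert x P)
  Q<i : All (_< i) (concat Q)
  Q<i = All-resp-↭ Q-labels <i
  x∷P! : Unique (x ∷ concat P)
  x∷P! = Unique-resp-↭ (↭.prep x P-labels) x∷w!
  snoc-↭ : ∀ (f : ℕ × ℕ → ℕ) {xs} → map f w ↭ xs → map f (w ∷ʳ (i , x)) ↭ f (i , x) ∷ xs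
  snoc-↭ f p = ↭-trans (map⁺ f (↭-sym (∷↭∷ʳ (i , x) w))) (↭.prep (f (i , x)) p)

-- The left fold inserts the rightmost letter last, so the induction removes letters from the right
-- end, as `Reverse` provides.
robinsonSchensted-invariant : ∀ {w} → Reverse w → AllPairs _<_ (map proj₁ w) →
                              Unique (map proj₂ w) → RSInvariant w (robinsonSchensted w)
robinsonSchensted-invariant [] _ _ = record
  { P-labels = ↭-refl ; Q-labels = ↭-refl ; P-sorted = [] ; Q-sorted = []
  ; sameShape = refl ; sign = refl }
robinsonSchensted-invariant (w ∶ rs ∶ʳ (i , x)) w↗ w! =
  subst (RSInvariant _) (sym (foldl-∷ʳ rsStep ([] , []) (i , x) w))
    (rsStep-invariant i x
      (All.map All.head (proj₂ (proj₂ w↗⁻)))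
      (Unique-resp-↭ (map⁺ proj₂ (↭-sym (∷↭∷ʳ (i , x) w))) w!)
      (robinsonSchensted-invariant rs (proj₁ w↗⁻) (proj₁ w!⁻)))
  where
  w↗⁻ = AllPairs-++⁻ (map proj₁ w) (subst (AllPairs _<_) (map-++ proj₁ w _) w↗)
  w!⁻ = AllPairs-++⁻ (map proj₂ w) (subst Unique (map-++ proj₂ w _) w!)

-- Inversions of multitableaux

∑-boxesFrom : ∀ m T f g → (∀ row x → m ≤ row → f (row , x) ≡ g x) →
              ∑ (boxesFrom m T) f ≡ ∑ (concat T) g
∑-boxesFrom m []      f g f≡g = refl
∑-boxesFrom m (t ∷ T) f g f≡g = trans (∑-++ (map (m ,_) t) _ f) (trans
  (cong₂ _+_ (trans (∑-map (m ,_) t f) (∑-cong t λ x → f≡g m x ℕ.≤-refl))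
             (∑-boxesFrom (suc m) T f g λ row x m<row → f≡g row x (ℕ.<⇒≤ m<row)))
  (sym (∑-++ t (concat T) g)))

isInversion : ℕ × ℕ → ℕ × ℕ → Parity
isInversion (rowᵢ , i) (rowⱼ , j) = 𝟙 (does (i ℕ.<? j) ∧ does (rowⱼ ℕ.<? rowᵢ))

isInversion-≤ : ∀ {row row′} i j → row ≤ row′ → isInversion (row , i) (row′ , j) ≡ 0ℙ
isInversion-≤ {row} {row′} i j ≤ = cong 𝟙
  (trans (cong (does (i ℕ.<? j) ∧_) (dec-false (row′ ℕ.<? row) (ℕ.≤⇒≯ ≤))) (∧-zeroʳ _))

isInversion-> : ∀ {row row′} i j → row′ < row → isInversion (row , i) (row′ , j) ≡ j >₂ i
isInversion-> {row} {row′} i j < = cong 𝟙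
  (trans (cong (does (i ℕ.<? j) ∧_) (dec-true (row′ ℕ.<? row) <)) (∧-identityʳ _))

-- A top box is never strictly below another, so it is never the lower member of a pair; lower boxes
-- paired with top ones give the cross term. Sortedness makes the pairs inside the top row vanish in
-- the reading word too. The first row number `m` varies for the induction.
∑-isInversion : ∀ m T → RowsSorted T →
  ∑ (boxesFrom m T) (λ x → ∑ (boxesFrom m T) (isInversion x)) ≡ inversions (concat T)
∑-isInversion m []      _           = refl
∑-isInversion m (t ∷ T) (t↗ ∷ T↗) = begin
  ∑ (X ++ Y) (λ x → ∑ (X ++ Y) (isInversion x))
    ≡⟨ ∑-++ X Y _ ⟩
  ∑ X (λ x → ∑ (X ++ Y) (isInversion x)) + ∑ Y (λ y → ∑ (X ++ Y) (isInversion y))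
    ≡⟨ cong₂ _+_ topRow belowTopRow ⟩
  0ℙ + (cross t (concat T) + inversions (concat T))
    ≡⟨ cong (_+ (cross t (concat T) + inversions (concat T))) (inversions-sorted t↗) ⟨
  inversions t + (cross t (concat T) + inversions (concat T))
    ≡⟨ inversions-++ t (concat T) ⟨
  inversions (t ++ concat T) ∎
  where
  open ≡-Reasoning
  X = map (m ,_) t
  Y = boxesFrom (suc m) T
  topRow : ∑ X (λ x → ∑ (X ++ Y) (isInversion x)) ≡ 0ℙ
  topRow = trans (∑-map (m ,_) t _) (trans
    (∑-cong t λ i → trans
      (∑-boxesFrom m (t ∷ T) _ (const 0ℙ) λ row j m≤row → isInversion-≤ i j m≤row)
      (∑-zero (t ++ concat T)))
    (∑-zero t))
  belowTopRow : ∑ Y (λ y → ∑ (X ++ Y) (isInversion y)) ≡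
                cross t (concat T) + inversions (concat T)
  belowTopRow = begin
    ∑ Y (λ y → ∑ (X ++ Y) (isInversion y))
      ≡⟨ ∑-cong Y (λ y → ∑-++ X Y (isInversion y)) ⟩
    ∑ Y (λ y → ∑ X (isInversion y) + ∑ Y (isInversion y))
      ≡⟨ ∑-+ Y _ _ ⟩
    ∑ Y (λ y → ∑ X (isInversion y)) + ∑ Y (λ y → ∑ Y (isInversion y))
      ≡⟨ cong₂ _+_
           (∑-boxesFrom (suc m) T _ (λ i → ∑ t (_>₂ i)) λ row i m<row →
             trans (∑-map (m ,_) t _) (∑-cong t λ j → isInversion-> i j m<row))
           (∑-isInversion (suc m) T T↗) ⟩
    ∑ (concat T) (λ i → ∑ t (_>₂ i)) + inversions (concat T)
      -- The summations are exchanged because `isInversion` takes the lower box first, while the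
      -- reading word has the upper row first.
      ≡⟨ cong (_+ inversions (concat T)) (∑-swap t (concat T) _>₂_) ⟨
    cross t (concat T) + inversions (concat T) ∎

parity-Inv : ∀ T → RowsSorted T → parity (length (Inv T)) ≡ inversions (concat T)
parity-Inv T T↗ =
  trans (cong parity (length-map _ (filter _ (cartesianProduct (boxes T) (boxes T)))))
  (trans (∣filter∣ _ (cartesianProduct (boxes T) (boxes T)))
  (trans (∑-cartesianProduct (boxes T) (boxes T) _)
         (∑-isInversion 1 T T↗)))

parity-Inv₂ : ∀ T U → parity (length (Inv₂ T U)) ≡ cross (concat T) (concat U)
parity-Inv₂ T U = trans (∣filter∣ _ (cartesianProduct (concat T) (concat U)))
  (∑-cartesianProduct (concat T) (concat U) _)

module _ {r : ℕ} where

  -- The parity of the inversions between different components. The indicator of `k < l` mirrors the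
  -- filter in `𝐈nv`, and a list `ks` of colours allows induction.
  crossings : (Fin r → List ℕ) → List (Fin r) → Parity
  crossings f ks = ∑ ks λ k → ∑ ks λ l → 𝟙 (does (k Fin.<? l)) ℙ.* cross (f k) (f l)

  crossings-cong : ∀ {f g} → (∀ k → f k ↭ g k) → ∀ ks → crossings f ks ≡ crossings g ks
  crossings-cong {f} {g} f↭g ks = ∑-cong ks λ k → ∑-cong ks λ l →
    cong (𝟙 (does (k Fin.<? l)) ℙ.*_) (cross-↭ (f↭g k) (f↭g l))

  -- As `k` precedes all of `ks`, the indicator kills the pair of `k` with itself and every pair
  -- with `k` second.
  crossings-∷ : ∀ f {k ks} → All (k Fin.<_) ks →
                crossings f (k ∷ ks) ≡ ∑ ks (λ l → cross (f k) (f l)) + crossings f ks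
  crossings-∷ f {k} {ks} k<ks = begin
    (c k k + ∑ ks (c k)) + ∑ ks (λ j → c j k + ∑ ks (c j))
      ≡⟨ cong₂ _+_ (cong₂ _+_ (lt k k (dec-false (k Fin.<? k) (Fin.<-irrefl refl)))
                              (∑-cong-local (All.map (λ {l} k<l → lt k l (dec-true (k Fin.<? l) k<l)) k<ks)))
                   (∑-cong-local (All.map (λ {j} k<j → cong (_+ ∑ ks (c j))
                      (lt j k (dec-false (j Fin.<? k) (Fin.<-asym k<j)))) k<ks)) ⟩
    ∑ ks (λ l → cross (f k) (f l)) + crossings f ks ∎
    where
    open ≡-Reasoning
    c : Fin r → Fin r → Parity
    c k l = 𝟙 (does (k Fin.<? l)) ℙ.* cross (f k) (f l)
    lt : ∀ k l {b} → does (k Fin.<? l) ≡ b → c k l ≡ 𝟙 b ℙ.* cross (f k) (f l)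
    lt k l = cong λ b → 𝟙 b ℙ.* cross (f k) (f l)

  cross-concatMap : ∀ xs (f : Fin r → List ℕ) ks →
                    cross xs (concatMap f ks) ≡ ∑ ks (λ l → cross xs (f l))
  cross-concatMap xs f []       = ∑-zero xs
  cross-concatMap xs f (k ∷ ks) = trans (∑-cong xs λ x → ∑-++ (f k) (concatMap f ks) (x >₂_))
    (trans (∑-+ xs _ _) (cong (cross xs (f k) +_) (cross-concatMap xs f ks)))

  -- With the blocks in increasing order of colour, the inversions between blocks are exactly the
  -- crossings.
  inversions-concatMap : ∀ f {ks} → AllPairs Fin._<_ ks →
    inversions (concatMap f ks) ≡ ∑ ks (inversions ∘ f) + crossings f ks
  inversions-concatMap f []                      = refl
  inversions-concatMap f {k ∷ ks} (k<ks ∷ ks↗) = begin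
    inversions (f k ++ concatMap f ks)
      ≡⟨ inversions-++ (f k) (concatMap f ks) ⟩
    inversions (f k) + (cross (f k) (concatMap f ks) + inversions (concatMap f ks))
      ≡⟨ cong₂ (λ p q → inversions (f k) + (p + q))
           (cross-concatMap (f k) f ks) (inversions-concatMap f ks↗) ⟩
    inversions (f k) + (c + (∑ ks (inversions ∘ f) + crossings f ks))
      ≡⟨ solve 4 (λ p q r s → p :+ (q :+ (r :+ s)) := (p :+ r) :+ (q :+ s)) refl
           (inversions (f k)) c (∑ ks (inversions ∘ f)) (crossings f ks) ⟩
    ∑ (k ∷ ks) (inversions ∘ f) + (c + crossings f ks)
      ≡⟨ cong (∑ (k ∷ ks) (inversions ∘ f) +_) (crossings-∷ f k<ks) ⟨
    ∑ (k ∷ ks) (inversions ∘ f) + crossings f (k ∷ ks) ∎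
    where
    open ≡-Reasoning
    c = ∑ ks (λ l → cross (f k) (f l))

  parity-inv : ∀ (𝐓 : Multitableau r) → (∀ k → RowsSorted (𝐓 k)) →
    parity (inv 𝐓) ≡ ∑ (allFin r) (inversions ∘ concat ∘ 𝐓) + crossings (concat ∘ 𝐓) (allFin r)
  parity-inv 𝐓 𝐓↗ = begin
    parity (inv 𝐓)
      ≡⟨ cong parity (length-++ (concatMap (Inv ∘ 𝐓) (allFin r))) ⟩
    parity (length (concatMap (Inv ∘ 𝐓) (allFin r)) ℕ.+ length (concatMap Inv₂∘𝐓 pairs))
      ≡⟨ ℙ.+-homo-+ (length (concatMap (Inv ∘ 𝐓) (allFin r))) _ ⟩
    parity (length (concatMap (Inv ∘ 𝐓) (allFin r))) + parity (length (concatMap Inv₂∘𝐓 pairs))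
      ≡⟨ cong₂ _+_
           (trans (∣concatMap∣ (Inv ∘ 𝐓) (allFin r))
                  (∑-cong (allFin r) λ k → parity-Inv (𝐓 k) (𝐓↗ k)))
           (trans (∣concatMap∣ Inv₂∘𝐓 pairs)
           (trans (∑-cong pairs λ (k , l) → parity-Inv₂ (𝐓 k) (𝐓 l))
           (trans (∑-filter (λ (k , l) → k Fin.<? l) (cartesianProduct (allFin r) (allFin r)) _)
                  (∑-cartesianProduct (allFin r) (allFin r) _)))) ⟩
    ∑ (allFin r) (inversions ∘ concat ∘ 𝐓) + crossings (concat ∘ 𝐓) (allFin r) ∎
    where
    open ≡-Reasoning
    Inv₂∘𝐓 : Fin r × Fin r → List (ℕ × ℕ)
    Inv₂∘𝐓 (k , l) = Inv₂ (𝐓 k) (𝐓 l)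
    pairs = filter (λ (k , l) → k Fin.<? l) (cartesianProduct (allFin r) (allFin r))

  -- Colour classes

  module _ (c : A → Fin r) where

    class : List A → Fin r → List A
    class xs k = filter (λ x → c x Fin.≟ k) xs

    -- Since `c x` occurs exactly once in `ks`, the new element enters a single class and leaves the
    -- others unchanged.
    classes-∷ : ∀ x xs {ks} → c x ∈ ks → Unique ks →
                concatMap (class (x ∷ xs)) ks ↭ x ∷ concatMap (class xs) ks
    classes-∷ x xs {k ∷ ks} (here refl) (k∉ks ∷ _) = ↭-reflexive (cong₂ _++_
      (filter-accept (λ x → c x Fin.≟ k) refl)
      (cong concat (map-cong-local (All.map (filter-reject (λ x → c x Fin.≟ _)) k∉ks))))
    classes-∷ x xs {k ∷ ks} (there cx∈ks) (k∉ks ∷ ks!) = ↭-trans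
      (↭-reflexive (cong (_++ concatMap (class (x ∷ xs)) ks)
        (filter-reject (λ x → c x Fin.≟ k) (≢-sym (All.lookup k∉ks cx∈ks)))))
      (↭-trans (++⁺ˡ (class xs k) (classes-∷ x xs cx∈ks ks!)) (shift x (class xs k) _))

    classes-↭ : ∀ xs → concatMap (class xs) (allFin r) ↭ xs
    classes-↭ []       = ↭-reflexive (concatMap-[] (allFin r))
      where
      concatMap-[] : ∀ ks → concatMap (class []) ks ≡ []
      concatMap-[] []       = refl
      concatMap-[] (k ∷ ks) = concatMap-[] ks
    classes-↭ (x ∷ xs) =
      ↭-trans (classes-∷ x xs (∈-allFin (c x)) (allFin⁺ r)) (↭.prep x (classes-↭ xs))

    sum-class : ∀ xs k → sum (map (toℕ ∘ c) (class xs k)) ≡ toℕ k ℕ.* length (class xs k)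
    sum-class xs k = trans (constant (All.all-filter (λ x → c x Fin.≟ k) xs)) (ℕ.*-comm _ (toℕ k))
      where
      constant : ∀ {ys} → All (λ x → c x ≡ k) ys → sum (map (toℕ ∘ c) ys) ≡ length ys ℕ.* toℕ k
      constant []           = refl
      constant (refl ∷ ys≡k) = cong (toℕ k ℕ.+_) (constant ys≡k)

    sum-classes : ∀ xs ks → sum (map (toℕ ∘ c) (concatMap (class xs) ks)) ≡
                            sum (map (λ k → toℕ k ℕ.* length (class xs k)) ks)
    sum-classes xs []       = refl
    sum-classes xs (k ∷ ks) = trans (cong sum (map-++ (toℕ ∘ c) (class xs k) _))
      (trans (sum-++ (map (toℕ ∘ c) (class xs k)) _)
             (cong₂ ℕ._+_ (sum-class xs k) (sum-classes xs ks)))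

    sum-colours : ∀ xs → sum (map (λ k → toℕ k ℕ.* length (class xs k)) (allFin r)) ≡
                         sum (map (toℕ ∘ c) xs)
    sum-colours xs = trans (sym (sum-classes xs (allFin r))) (sum-↭ (map⁺ (toℕ ∘ c) (classes-↭ xs)))

-- The sign of a permutation from its coloured tableaux

oneLine : ∀ {n} → (Fin n → Fin n) → List ℕ
oneLine {n} σ = map (λ i → suc (toℕ (σ i))) (allFin n)

module _ {r n : ℕ} (a : Fin n → Fin r) (σ : Fin n → Fin n) (σ-injective : Injective _≡_ _≡_ σ) where

  private
    𝐏 = proj₁ (windowRS a σ)
    𝐐 = proj₂ (windowRS a σ)

    letter : Fin n → ℕ × ℕ
    letter i = suc (toℕ i) , suc (toℕ (σ i))

    biword = map letter (allFin n)

    positions values : Fin r → List ℕ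
    positions k = map proj₁ (colourWord a σ k)
    values    k = map proj₂ (colourWord a σ k)

  positions-sorted : ∀ k → AllPairs _<_ (positions k)
  positions-sorted k = AllPairs.map⁺ (AllPairs.map⁺
    (AllPairs.filter⁺ (λ i → a i Fin.≟ k) (AllPairs.tabulate⁺-< ℕ.s<s)))

  values-unique : ∀ k → Unique (values k)
  values-unique k = AllPairs.map⁺ (AllPairs.map⁺ (AllPairs.filter⁺ (λ i → a i Fin.≟ k)
    (AllPairs.map (λ i≢j → i≢j ∘ σ-injective ∘ Fin.toℕ-injective ∘ ℕ.suc-injective) (allFin⁺ n))))

  invariant : ∀ k → RSInvariant (colourWord a σ k) (robinsonSchensted (colourWord a σ k))
  invariant k = robinsonSchensted-invariant (reverseView _) (positions-sorted k) (values-unique k)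

  private
    module I k = RSInvariant (invariant k)

  size-𝐏 : ∀ k → size (𝐏 k) ≡ length (class a (allFin n) k)
  size-𝐏 k = trans (↭-length (↭-sym (I.P-labels k)))
    (trans (length-map proj₂ (colourWord a σ k)) (length-map letter (class a (allFin n) k)))

  size-𝐐 : ∀ k → size (𝐐 k) ≡ length (class a (allFin n) k)
  size-𝐐 k = trans (↭-length (↭-sym (I.Q-labels k)))
    (trans (length-map proj₁ (colourWord a σ k)) (length-map letter (class a (allFin n) k)))

  -- Double counting: a box of colour `k` stands for a letter with exponent `k`, so twice the spin
  -- of such a multitableau is the sum of the exponents.
  weight : ∀ (𝐓 : Multitableau r) → (∀ k → size (𝐓 k) ≡ length (class a (allFin n) k)) →
           sum (map (λ k → toℕ k ℕ.* size (𝐓 k)) (allFin r)) ≡ sum (map (toℕ ∘ a) (allFin n))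
  weight 𝐓 size≡ = trans (cong sum (map-cong (λ k → cong (toℕ k ℕ.*_) (size≡ k)) (allFin r)))
                       (sum-colours a (allFin n))

  colourWords-↭ : concatMap (colourWord a σ) (allFin r) ↭ biword
  colourWords-↭ = ↭-trans (↭-reflexive (sym (map-concatMap letter (class a (allFin n)) (allFin r))))
                          (map⁺ letter (classes-↭ a (allFin n)))

  -- The positions of the whole biword increase, so their inversions can be added for free;
  -- `inversions-biword` then permits regrouping the letters by colour.
  inversions-oneLine-RS : inversions (oneLine σ) ≡
    parity (e 𝐏) + (parity (inv 𝐏) + parity (inv 𝐐))
  inversions-oneLine-RS = begin
    inversions (oneLine σ)
      ≡⟨ cong₂ _+_ (inversions-sorted positions↗) (cong inversions (sym (map-∘ (allFin n)))) ⟨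
    inversions (map proj₁ biword) + inversions (map proj₂ biword)
      ≡⟨ inversions-biword (↭-sym colourWords-↭) (AllPairs.map ℕ.<⇒≢ positions↗′) values! ⟩
    inversions (map proj₁ (concatMap (colourWord a σ) (allFin r))) +
    inversions (map proj₂ (concatMap (colourWord a σ) (allFin r)))
      ≡⟨ cong₂ _+_ (split proj₁) (split proj₂) ⟩
    (∑ (allFin r) (inversions ∘ positions) + crossings positions (allFin r)) +
    (∑ (allFin r) (inversions ∘ values) + crossings values (allFin r))
      ≡⟨ cong₂ _+_
           -- Within a colour the positions still increase, so only their crossings survive; these
           -- become the crossings of `𝐐`.
           (cong₂ _+_ (trans (∑-cong (allFin r) λ k → inversions-sorted (AllPairs.map ℕ.<⇒≤ (positions-sorted k)))
                             (∑-zero (allFin r)))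
                      (crossings-cong I.Q-labels (allFin r)))
           (cong₂ _+_ (trans (∑-cong (allFin r) I.sign)
                      (trans (∑-+ (allFin r) _ _) (cong (E +_) (∑-+ (allFin r) _ _))))
                      (crossings-cong I.P-labels (allFin r))) ⟩
    (0ℙ + XQ) + ((E + (IP + IQ)) + XP)
      ≡⟨ solve 5 (λ xq e p q xp → xq :+ ((e :+ (p :+ q)) :+ xp) := e :+ ((p :+ xp) :+ (q :+ xq))) refl
           XQ E IP IQ XP ⟩
    E + ((IP + XP) + (IQ + XQ))
      ≡⟨ cong₂ _+_ (parity-sum (evenBoxes ∘ 𝐏) (allFin r))
                   (cong₂ _+_ (parity-inv 𝐏 I.P-sorted) (parity-inv 𝐐 I.Q-sorted)) ⟨
    parity (e 𝐏) + (parity (inv 𝐏) + parity (inv 𝐐)) ∎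
    where
    open ≡-Reasoning
    E = ∑ (allFin r) (parity ∘ evenBoxes ∘ 𝐏)
    IP = ∑ (allFin r) (inversions ∘ concat ∘ 𝐏)
    IQ = ∑ (allFin r) (inversions ∘ concat ∘ 𝐐)
    XP = crossings (concat ∘ 𝐏) (allFin r)
    XQ = crossings (concat ∘ 𝐐) (allFin r)
    positions↗′ : AllPairs _<_ (map proj₁ biword)
    positions↗′ = AllPairs.map⁺ (AllPairs.map⁺ (AllPairs.tabulate⁺-< ℕ.s<s))
    positions↗ : AllPairs _≤_ (map proj₁ biword)
    positions↗ = AllPairs.map ℕ.<⇒≤ positions↗′
    values! : Unique (map proj₂ biword)
    values! = AllPairs.map⁺ (AllPairs.map⁺ (AllPairs.map
      (λ i≢j → i≢j ∘ σ-injective ∘ Fin.toℕ-injective ∘ ℕ.suc-injective) (allFin⁺ n)))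
    split : ∀ (f : ℕ × ℕ → ℕ) → let g = map f ∘ colourWord a σ in
      inversions (map f (concatMap (colourWord a σ) (allFin r))) ≡
      ∑ (allFin r) (inversions ∘ g) + crossings g (allFin r)
    split f = trans (cong inversions (map-concatMap f (colourWord a σ) (allFin r)))
      (inversions-concatMap (map f ∘ colourWord a σ) (AllPairs.tabulate⁺-< id))

-- Transpositions

module _ {n : ℕ} where

  transposeˡ : ∀ (i j : Fin n) → PC.transpose i j i ≡ j
  transposeˡ i j rewrite dec-true (i Fin.≟ i) refl = refl

  transposeʳ : ∀ (i j : Fin n) → PC.transpose i j j ≡ i
  transposeʳ i j with j Fin.≟ i
  ... | yes j≡i = j≡i
  ... | no  _ rewrite dec-true (j Fin.≟ j) refl = refl

  transpose-≢ : ∀ {i j k : Fin n} → k ≢ i → k ≢ j → PC.transpose i j k ≡ k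
  transpose-≢ {i} {j} {k} k≢i k≢j
    rewrite dec-false (k Fin.≟ i) k≢i | dec-false (k Fin.≟ j) k≢j = refl

  transpose-elim : ∀ (R : Fin n → Set ℓ) {i j} →
                   R i → R j → (∀ {k} → k ≢ i → k ≢ j → R k) → ∀ k → R k
  transpose-elim R {i} {j} Ri Rj R≢ k with k Fin.≟ i | k Fin.≟ j
  ... | yes refl | _        = Ri
  ... | no  _    | yes refl = Rj
  ... | no  k≢i  | no  k≢j  = R≢ k≢i k≢j

  transpose-comm : ∀ (i j : Fin n) → PC.transpose i j ≗ PC.transpose j i
  transpose-comm i j = transpose-elim _
    (trans (transposeˡ i j) (sym (transposeʳ j i)))
    (trans (transposeʳ i j) (sym (transposeˡ j i)))
    (λ k≢i k≢j → trans (transpose-≢ k≢i k≢j) (sym (transpose-≢ k≢j k≢i)))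

  transpose-refl : ∀ (i k : Fin n) → PC.transpose i i k ≡ k
  transpose-refl i = transpose-elim _ (transposeˡ i i) (transposeˡ i i) transpose-≢

  -- Taken with `k` the successor of `j`, this reduces a transposition to one of smaller span and
  -- two adjacent ones.
  transpose-conj : ∀ {i j k : Fin n} → i ≢ j → i ≢ k → j ≢ k → ∀ x →
    PC.transpose j k (PC.transpose i j (PC.transpose j k x)) ≡ PC.transpose i k x
  transpose-conj {i} {j} {k} i≢j i≢k j≢k = transpose-elim _
    (trans (cong (t ∘ s) (transpose-≢ i≢j i≢k))
      (trans (cong t (transposeˡ i j)) (trans (transposeˡ j k) (sym (transposeˡ i k)))))
    (trans (cong (t ∘ s) (transposeʳ j k))
      (trans (cong t (transposeʳ i j)) (trans (transpose-≢ i≢j i≢k) (sym (transposeʳ i k)))))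
    (λ {x} → transpose-elim (λ x → x ≢ i → x ≢ k → t (s (t x)) ≡ PC.transpose i k x)
      x≡j x≡j
      (λ x≢j _ x≢i x≢k → trans (cong (t ∘ s) (transpose-≢ x≢j x≢k))
        (trans (cong t (transpose-≢ x≢i x≢j))
        (trans (transpose-≢ x≢j x≢k) (sym (transpose-≢ x≢i x≢k)))))
      x)
    where
    s = PC.transpose i j
    t = PC.transpose j k
    x≡j : j ≢ i → j ≢ k → t (s (t j)) ≡ PC.transpose i k j
    x≡j j≢i j≢k = trans (cong (t ∘ s) (transposeˡ j k))
      (trans (cong t (transpose-≢ (≢-sym i≢k) (≢-sym j≢k)))
      (trans (transposeʳ j k) (sym (transpose-≢ j≢i j≢k))))

-- Induction on permutations by adjacent transpositions

module AdjacentInduction {n} (R : Permutation′ n → Set ℓ)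
  (resp     : ∀ {π ρ} → π Perm.≈ ρ → R π → R ρ)
  (id∈      : R Perm.id)
  (adjacent : ∀ j j′ → toℕ j′ ≡ suc (toℕ j) → ∀ π → R π → R (transpose j j′ ∘ₚ π))
  where

  -- Induction on the number `d` of points strictly between `i` and `k`; in the step, `j` is the
  -- predecessor of `k`.
  increasing : ∀ d i k → toℕ k ≡ suc (d ℕ.+ toℕ i) → ∀ π → R π → R (transpose i k ∘ₚ π)
  increasing zero    i k k≡ π Rπ = adjacent i k k≡ π Rπ
  increasing (suc d) i k k≡ π Rπ =
    resp (λ x → cong (π ⟨$⟩ʳ_) (transpose-conj i≢j i≢k j≢k x))
      (adjacent j k k≡1+j (transpose i j ∘ₚ transpose j k ∘ₚ π)
        (increasing d i j j≡ (transpose j k ∘ₚ π) (adjacent j k k≡1+j π Rπ)))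
    where
    j<n : suc (d ℕ.+ toℕ i) < n
    j<n = ℕ.<-trans (ℕ.≤-reflexive (sym k≡)) (Fin.toℕ<n k)
    j = fromℕ< j<n
    j≡ : toℕ j ≡ suc (d ℕ.+ toℕ i)
    j≡ = Fin.toℕ-fromℕ< j<n
    k≡1+j : toℕ k ≡ suc (toℕ j)
    k≡1+j = trans k≡ (cong suc (sym j≡))
    j≢k : j ≢ k
    j≢k = Fin.<⇒≢ (ℕ.≤-reflexive (sym k≡1+j))
    i<j : i Fin.< j
    i<j = ℕ.≤-trans (ℕ.s≤s (ℕ.m≤n+m (toℕ i) d)) (ℕ.≤-reflexive (sym j≡))
    i≢j : i ≢ j
    i≢j = Fin.<⇒≢ i<j
    i≢k : i ≢ k
    i≢k = Fin.<⇒≢ (ℕ.<-trans i<j (ℕ.≤-reflexive (sym k≡1+j)))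

  <-transposition : ∀ {i k} → i Fin.< k → ∀ π → R π → R (transpose i k ∘ₚ π)
  <-transposition {i} {k} i<k = increasing (toℕ k ℕ.∸ suc (toℕ i)) i k
    (sym (trans (sym (ℕ.+-suc (toℕ k ℕ.∸ suc (toℕ i)) (toℕ i))) (ℕ.m∸n+n≡m i<k)))

  transposition : ∀ i k π → R π → R (transpose i k ∘ₚ π)
  transposition i k π Rπ with Fin.<-cmp i k
  ... | tri< i<k _ _  = <-transposition i<k π Rπ
  ... | tri≈ _ refl _ = resp (λ x → cong (π ⟨$⟩ʳ_) (sym (transpose-refl i x))) Rπ
  ... | tri> _ _ k<i  = resp (λ x → cong (π ⟨$⟩ʳ_) (transpose-comm k i x)) (<-transposition k<i π Rπ)

  -- Every permutation is a product of transpositions; the product agrees with it only pointwise,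
  -- hence `resp`.
  everywhere : ∀ π → R π
  everywhere π = resp (eval-decompose π) (products (decompose π))
    where
    products : ∀ ts → R (eval ts)
    products []             = id∈
    products ((i , k) ∷ ts) = transposition i k (eval ts) (products ts)

-- Inversions under an adjacent transposition

tabulate-transpose-↭ : ∀ {n} (f : Fin n → ℕ) j j′ → toℕ j′ ≡ suc (toℕ j) →
  tabulate (f ∘ PC.transpose j j′) ↭ tabulate f
tabulate-transpose-↭ f zero    (suc zero) _ = ↭.swap (f (suc zero)) (f zero) ↭-refl
tabulate-transpose-↭ f (suc j) (suc j′) j′≡ = ↭.prep (f zero)
  (↭-trans (↭-reflexive (tabulate-cong λ k → cong f (lift₀-transpose j j′ (suc k))))
           (tabulate-transpose-↭ (f ∘ suc) j j′ (ℕ.suc-injective j′≡)))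

-- Only the two exchanged neighbours change their relative order, and injectivity makes these
-- letters distinct.
inversions-tabulate-transpose : ∀ {n} (f : Fin n → ℕ) → Injective _≡_ _≡_ f →
  ∀ j j′ → toℕ j′ ≡ suc (toℕ j) →
  inversions (tabulate (f ∘ PC.transpose j j′)) ≡ 1ℙ + inversions (tabulate f)
inversions-tabulate-transpose {suc (suc n)} f f-inj zero (suc zero) _ = trans
  -- Adding `q` twice isolates `q + p`, the exchanged pair in both orders, which `>₂-flip` evaluates
  -- to `1ℙ`.
  (solve 5 (λ p q a b c → (p :+ a) :+ (b :+ c) := (q :+ p) :+ ((q :+ b) :+ (a :+ c))) refl
     (f (suc zero) >₂ f zero) (f zero >₂ f (suc zero)) (∑ fs (f (suc zero) >₂_)) (∑ fs (f zero >₂_))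
     (inversions fs))
  (cong (_+ inversions (tabulate f)) (>₂-flip λ eq → Fin.0≢1+n (f-inj eq)))
  where
  fs = tabulate {n = n} (λ k → f (suc (suc k)))
inversions-tabulate-transpose f f-inj (suc j) (suc j′) j′≡ = trans
  (cong₂ _+_ (∑-↭ (f zero >₂_) (↭-trans (↭-reflexive suc≡) (tabulate-transpose-↭ (f ∘ suc) j j′ j′≡′)))
             (trans (cong inversions suc≡)
                    (inversions-tabulate-transpose (f ∘ suc) (Fin.suc-injective ∘ f-inj) j j′ j′≡′)))
  (solve 2 (λ p q → p :+ (con 1ℙ :+ q) := con 1ℙ :+ (p :+ q)) refl
     (∑ (tabulate (f ∘ suc)) (f zero >₂_)) (inversions (tabulate (f ∘ suc))))
  where
  j′≡′ = ℕ.suc-injective j′≡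
  suc≡ : tabulate (f ∘ PC.transpose (suc j) (suc j′) ∘ suc) ≡ tabulate (f ∘ suc ∘ PC.transpose j j′)
  suc≡ = tabulate-cong λ k → cong f (lift₀-transpose j j′ (suc k))

⟨$⟩ʳ-injective : ∀ {n} (π : Permutation′ n) → Injective _≡_ _≡_ (π ⟨$⟩ʳ_)
⟨$⟩ʳ-injective π = Injection.injective (Inverse⇒Injection π)

inversions-oneLine-id : ∀ n → inversions (oneLine {n} id) ≡ 0ℙ
inversions-oneLine-id n = inversions-sorted sorted
  where
  sorted : AllPairs _≤_ (oneLine {n} id)
  sorted = AllPairs.map⁺ (AllPairs.tabulate⁺-< (ℕ.<⇒≤ ∘ ℕ.s<s))

inversions-oneLine-transpose : ∀ {n} (π : Permutation′ n) j j′ → toℕ j′ ≡ suc (toℕ j) →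
  inversions (oneLine (transpose j j′ ∘ₚ π ⟨$⟩ʳ_)) ≡ 1ℙ + inversions (oneLine (π ⟨$⟩ʳ_))
inversions-oneLine-transpose π j j′ j′≡ = trans
  (cong inversions (map-tabulate id (λ k → suc (toℕ (transpose j j′ ∘ₚ π ⟨$⟩ʳ k)))))
  (trans (inversions-tabulate-transpose (λ k → suc (toℕ (π ⟨$⟩ʳ k)))
            (⟨$⟩ʳ-injective π ∘ Fin.toℕ-injective ∘ ℕ.suc-injective) j j′ j′≡)
         (cong (λ xs → 1ℙ + inversions xs) (sym (map-tabulate id (λ k → suc (toℕ (π ⟨$⟩ʳ k)))))))

-- The exponents of the diagonal matrix with `ζ` in position `j` and ones elsewhere.
δ : ∀ {n} → Fin n → Fin n → ℕ
δ j k = if does (k Fin.≟ j) then 1 else 0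

δ-refl : ∀ {n} (j : Fin n) → δ j j ≡ 1
δ-refl j rewrite dec-true (j Fin.≟ j) refl = refl

δ-≢ : ∀ {n} {j k : Fin n} → k ≢ j → δ j k ≡ 0
δ-≢ {j = j} {k} k≢j rewrite dec-false (k Fin.≟ j) k≢j = refl

δ-transpose : ∀ {n} (j k : Fin (suc n)) → δ zero (PC.transpose j zero k) ≡ δ j k
δ-transpose j = transpose-elim _
  (trans (cong (δ zero) (transposeˡ j zero)) (sym (δ-refl j)))
  (trans (cong (δ zero) (transposeʳ j zero)) (δ-comm j))
  (λ k≢j k≢0 → trans (cong (δ zero) (transpose-≢ k≢j k≢0)) (trans (δ-≢ k≢0) (sym (δ-≢ k≢j))))
  where
  δ-comm : ∀ {n} (j : Fin (suc n)) → δ zero j ≡ δ j zero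
  δ-comm zero    = refl
  δ-comm (suc _) = refl

-- The sign representations

module Representation
  {c ℓ₁ ℓ₂} (K : HeytingField c ℓ₁ ℓ₂) (r : ℕ) .{{_ : NonZero r}}
  (ζ : HeytingField.Carrier K) (ζ-prim : IsPrimitiveRoot K r ζ)
  where

  open ReflectionGroup K r ζ ζ-prim using
    (_≋_; G; W; 𝐏; 𝐐; sign; ≈power⇒#0; ∑-single; 1^; window; _∙_; s; s₀; IsSgn)
  open IsPrimitiveRoot ζ-prim using (ζ^r≈1)
  open CommutativeRing (commutativeRing K)
    using (Carrier; _≈_; 0#; 1#; -_; commutativeSemiring; zeroʳ)
    renaming ( setoid to ≈-setoid; _*_ to _·_; *-cong to ·-cong; *-congˡ to ·-congˡ
             ; *-congʳ to ·-congʳ; *-assoc to ·-assoc; *-comm to ·-comm; *-identityˡ to ·-identityˡ; *-identityʳ to ·-identityʳ; ring to R)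
  open RingProperties R using (-1*x≈-x; -‿involutive)
  open Exp commutativeSemiring using (_^_; ^-congˡ; ^-congʳ; ^-homo-*; ^-assocʳ)
  module ≈ = CommutativeRing (commutativeRing K) using (refl; sym; trans; reflexive)
  open SetoidReasoning ≈-setoid

  sgn : Parity → Carrier
  sgn 0ℙ = 1#
  sgn 1ℙ = - 1#

  sgn-+ : ∀ p q → sgn (p + q) ≈ sgn p · sgn q
  sgn-+ 0ℙ q  = ≈.sym (·-identityˡ _)
  sgn-+ 1ℙ 0ℙ = ≈.sym (·-identityʳ _)
  sgn-+ 1ℙ 1ℙ = ≈.sym (≈.trans (-1*x≈-x (- 1#)) (-‿involutive 1#))

  [-1]^≈sgn : ∀ m → (- 1#) ^ m ≈ sgn (parity m)
  [-1]^≈sgn zero    = ≈.refl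
  [-1]^≈sgn (suc m) = begin
    - 1# · (- 1#) ^ m          ≈⟨ ·-congˡ ([-1]^≈sgn m) ⟩
    sgn 1ℙ · sgn (parity m)    ≈⟨ sgn-+ 1ℙ (parity m) ⟨
    sgn (1ℙ + parity m)        ≡⟨ cong sgn (parity-suc m) ⟨
    sgn (parity (suc m))       ∎

  -- The colour of a column keeps an exponent only modulo `r`; this recovers the matrix entry from
  -- it.
  ζ^[k%r]≈ζ^k : ∀ k → ζ ^ toℕ (k mod r) ≈ ζ ^ k
  ζ^[k%r]≈ζ^k k = begin
    ζ ^ toℕ (k mod r)                   ≡⟨ cong (ζ ^_) (Fin.toℕ-fromℕ< (m%n<n k r)) ⟩
    ζ ^ (k % r)                         ≈⟨ ·-identityʳ _ ⟨
    ζ ^ (k % r) · 1#                    ≈⟨ ·-congˡ (1^ (k / r)) ⟨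
    ζ ^ (k % r) · 1# ^ (k / r)          ≈⟨ ·-congˡ (^-congˡ (k / r) ζ^r≈1) ⟨
    ζ ^ (k % r) · (ζ ^ r) ^ (k / r)     ≈⟨ ·-congˡ (^-assocʳ ζ r (k / r)) ⟩
    ζ ^ (k % r) · ζ ^ (r ℕ.* (k / r))   ≈⟨ ^-homo-* ζ (k % r) _ ⟨
    ζ ^ (k % r ℕ.+ r ℕ.* (k / r))
      ≡⟨ cong (λ m → ζ ^ (k % r ℕ.+ m)) (ℕ.*-comm r (k / r)) ⟩
    ζ ^ (k % r ℕ.+ k / r ℕ.* r)         ≡⟨ cong (ζ ^_) (m≡m%n+[m/n]*n k r) ⟨
    ζ ^ k                               ∎

  -- Elements of W n

  module _ {n : ℕ} where

    nonZeroEntry : W n → Fin n → Carrier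
    nonZeroEntry A j = G.matrix A (G.row A j) j

    zeroEntry : ∀ (A : W n) {i j} → i ≢ G.row A j → G.matrix A i j ≈ 0#
    zeroEntry A {i} {j} i≢ with G.entry A i j
    ... | inj₁ ≈0       = ≈0
    ... | inj₂ (k , ≈ζ) = contradiction (G.row-unique A (≈power⇒#0 k ≈ζ)) i≢

    -- Outside the positions given by `row` both matrices vanish, so one comparison per column is
    -- enough.
    ≋-intro : ∀ (A B : W n) → G.row A ≗ G.row B →
              (∀ j → nonZeroEntry A j ≈ nonZeroEntry B j) → G.matrix A ≋ G.matrix B
    ≋-intro A B row≗ entry≈ i j with i Fin.≟ G.row A j
    ... | yes refl = ≈.trans (entry≈ j) (≈.reflexive (cong (λ i → G.matrix B i j) (sym (row≗ j))))
    ... | no  i≢   = ≈.trans (zeroEntry A i≢) (≈.sym (zeroEntry B (i≢ ∘ flip trans (sym (row≗ j)))))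

    nonZeroEntry-∙ : ∀ A B j →
      nonZeroEntry (A ∙ B) j ≈ nonZeroEntry A (G.row B j) · nonZeroEntry B j
    nonZeroEntry-∙ A B j = ∑-single _ (G.row B j)
      λ k k≢ → ≈.trans (·-congˡ (zeroEntry B k≢)) (zeroʳ _)

    nonZeroEntry-window : ∀ a (π : Permutation′ n) j → nonZeroEntry (window a π) j ≈ ζ ^ a j
    nonZeroEntry-window a π j rewrite dec-true ((π ⟨$⟩ʳ j) Fin.≟ (π ⟨$⟩ʳ j)) refl = ≈.refl

    row-permutation : W n → Permutation′ n
    row-permutation A = permutation (G.row A) (G.col A)
      (λ i → sym (G.row-unique A (G.col-#0 A i)))
      (λ j → sym (G.col-unique A (G.row-#0 A j)))

    ≋-window : ∀ A → G.matrix A ≋ G.matrix (window (toℕ ∘ G.colour A) (row-permutation A))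
    ≋-window A = ≋-intro A (window (toℕ ∘ G.colour A) (row-permutation A)) (λ _ → refl) λ j →
      let (k , ≈ζ) = G.power A (G.row-#0 A j) in begin
        nonZeroEntry A j          ≈⟨ ≈ζ ⟩
        ζ ^ k                     ≈⟨ ζ^[k%r]≈ζ^k k ⟨
        ζ ^ toℕ (G.colour A j)    ≈⟨ nonZeroEntry-window (toℕ ∘ G.colour A) (row-permutation A) j ⟨
        nonZeroEntry (window (toℕ ∘ G.colour A) (row-permutation A)) j ∎

    -- The exponents of `s₀` are defined by matching on the column, so the two sides agree by
    -- computation only after `j` is split.
    s₀≋ : G.matrix (s₀ {suc n}) ≋ G.matrix (window {suc n} (δ zero) Perm.id)
    s₀≋ i zero    = ≈.refl
    s₀≋ i (suc j) = ≈.refl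

  -- The sign character on diagonal and permutation matrices

  extend : ∀ {n} → (Fin n → ℕ) → Fin (suc n) → ℕ
  extend a zero    = 0
  extend a (suc j) = a j

  -- A homomorphism on exponent vectors is determined by its values on the unit vectors `δ j`.
  -- Vectors agree only pointwise, hence `ψ-cong`.
  additive≈^sum : ∀ {n} z (ψ : (Fin n → ℕ) → Carrier) →
    (∀ {a b} → a ≗ b → ψ a ≈ ψ b) → ψ (const 0) ≈ 1# →
    (∀ a b → ψ (λ j → a j ℕ.+ b j) ≈ ψ a · ψ b) →
    (∀ j → ψ (δ j) ≈ z) → ∀ a → ψ a ≈ z ^ sum (tabulate a)
  additive≈^sum {zero}  z ψ ψ-cong ψ0 ψ+ ψδ a = ≈.trans (ψ-cong λ ()) ψ0
  additive≈^sum {suc n} z ψ ψ-cong ψ0 ψ+ ψδ a = begin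
    ψ a
      -- The vector is split into a multiple of the first unit vector and its remaining entries,
      -- extended by 0.
      ≈⟨ ψ-cong (λ { zero → sym (trans (ℕ.+-identityʳ _) (ℕ.*-identityʳ _))
                   ; (suc j) → sym (cong (ℕ._+ a (suc j)) (ℕ.*-zeroʳ (a zero))) }) ⟩
    ψ (λ j → a zero ℕ.* δ zero j ℕ.+ extend (a ∘ suc) j)
      ≈⟨ ψ+ _ _ ⟩
    ψ (λ j → a zero ℕ.* δ zero j) · ψ (extend (a ∘ suc))
      ≈⟨ ·-cong (multiple (a zero)) (additive≈^sum z (ψ ∘ extend)
           (λ a≗b → ψ-cong λ { zero → refl ; (suc j) → a≗b j })
           (≈.trans (ψ-cong λ { zero → refl ; (suc j) → refl }) ψ0)
           (λ a b → ≈.trans (ψ-cong λ { zero → refl ; (suc j) → refl }) (ψ+ _ _))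
           (λ j → ≈.trans (ψ-cong λ { zero → refl ; (suc k) → refl }) (ψδ (suc j)))
           (a ∘ suc)) ⟩
    z ^ a zero · z ^ sum (tabulate (a ∘ suc))
      ≈⟨ ^-homo-* z (a zero) _ ⟨
    z ^ sum (tabulate a) ∎
    where
    multiple : ∀ m → ψ (λ j → m ℕ.* δ zero j) ≈ z ^ m
    multiple zero    = ψ0
    multiple (suc m) = ≈.trans (ψ+ _ _) (·-cong (ψδ zero) (multiple m))

  module _ {n : ℕ} {i : Fin r} {φ : W n → Carrier} (isSgn : IsSgn i φ) where

    open IsSgn isSgn
    open MonoidMorphisms.IsMonoidHomomorphism isMonoidHomomorphism
      using (homo; ε-homo) renaming (⟦⟧-cong to φ-cong)

    φ-window-cong : ∀ {a b π ρ} → a ≗ b → π Perm.≈ ρ → φ (window a π) ≈ φ (window b ρ)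
    φ-window-cong {a} {b} {π} {ρ} a≗b π≈ρ =
      φ-cong {window a π} {window b ρ} (≋-intro (window a π) (window b ρ) π≈ρ λ j → begin
        nonZeroEntry (window a π) j  ≈⟨ nonZeroEntry-window a π j ⟩
        ζ ^ a j                      ≡⟨ cong (ζ ^_) (a≗b j) ⟩
        ζ ^ b j                      ≈⟨ nonZeroEntry-window b ρ j ⟨
        nonZeroEntry (window b ρ) j  ∎)

    -- In the product, column `j` of the right factor meets column `ρ j` of the left one, so these
    -- exponents add; `ρ ∘ₚ π` applies `ρ` first.
    φ-window-∙ : ∀ a π b ρ →
      φ (window (λ j → a (ρ ⟨$⟩ʳ j) ℕ.+ b j) (ρ ∘ₚ π)) ≈ φ (window a π) · φ (window b ρ)
    φ-window-∙ a π b ρ = ≈.trans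
      (φ-cong {window ab (ρ ∘ₚ π)} {M ∙ N} (≋-intro (window ab (ρ ∘ₚ π)) (M ∙ N) (λ _ → refl) λ j → begin
        nonZeroEntry (window ab (ρ ∘ₚ π)) j          ≈⟨ nonZeroEntry-window ab (ρ ∘ₚ π) j ⟩
        ζ ^ (a (ρ ⟨$⟩ʳ j) ℕ.+ b j)                   ≈⟨ ^-homo-* ζ (a (ρ ⟨$⟩ʳ j)) (b j) ⟩
        ζ ^ a (ρ ⟨$⟩ʳ j) · ζ ^ b j
          ≈⟨ ·-cong (nonZeroEntry-window a π (ρ ⟨$⟩ʳ j)) (nonZeroEntry-window b ρ j) ⟨
        nonZeroEntry M (ρ ⟨$⟩ʳ j) · nonZeroEntry N j ≈⟨ nonZeroEntry-∙ M N j ⟨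
        nonZeroEntry (M ∙ N) j                       ∎))
      (homo M N)
      where
      M = window a π
      N = window b ρ
      ab = λ j → a (ρ ⟨$⟩ʳ j) ℕ.+ b j

    -- Right multiplication by an adjacent transposition multiplies both sides by `- 1#`, and both
    -- are 1 at the identity.
    φ-permutation : ∀ π → φ (window (const 0) π) ≈ sgn (inversions (oneLine (π ⟨$⟩ʳ_)))
    φ-permutation = AdjacentInduction.everywhere
      (λ π → φ (window (const 0) π) ≈ sgn (inversions (oneLine (π ⟨$⟩ʳ_))))
      (λ {π} {ρ} π≈ρ φπ → ≈.trans (φ-window-cong {π = ρ} {π} (λ _ → refl) (sym ∘ π≈ρ))
        (≈.trans φπ (≈.reflexive (cong (sgn ∘ inversions)
          (map-cong (λ j → cong (suc ∘ toℕ) (π≈ρ j)) (allFin n))))))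
      (≈.trans ε-homo (≈.reflexive (cong sgn (sym (inversions-oneLine-id n)))))
      λ j j′ j′≡ π φπ → begin
        φ (window (const 0) (transpose j j′ ∘ₚ π))
          ≈⟨ φ-window-∙ (const 0) π (const 0) (transpose j j′) ⟩
        φ (window (const 0) π) · φ (s j j′)
          ≈⟨ ·-cong φπ (φ-s j j′ j′≡) ⟩
        sgn (inversions (oneLine (π ⟨$⟩ʳ_))) · sgn 1ℙ
          ≈⟨ ·-comm _ _ ⟩
        sgn 1ℙ · sgn (inversions (oneLine (π ⟨$⟩ʳ_)))
          ≈⟨ sgn-+ 1ℙ (inversions (oneLine (π ⟨$⟩ʳ_))) ⟨
        sgn (1ℙ + inversions (oneLine (π ⟨$⟩ʳ_)))
          ≡⟨ cong sgn (inversions-oneLine-transpose π j j′ j′≡) ⟨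
        sgn (inversions (oneLine (transpose j j′ ∘ₚ π ⟨$⟩ʳ_))) ∎

  -- The two matrices are mutually inverse. They are kept in this form because conjugating `s₀` puts
  -- one of them on each side.
  φ-transpose² : ∀ {n i} {φ : W n → Carrier} → IsSgn i φ → ∀ j k → φ (s j k) · φ (s k j) ≈ 1#
  φ-transpose² isSgn j k = ≈.trans
    (≈.sym (φ-window-∙ isSgn (const 0) (transpose j k) (const 0) (transpose k j)))
    (≈.trans (φ-window-cong isSgn {π = transpose k j ∘ₚ transpose j k} {Perm.id} (λ _ → refl)
               (λ x → PC.transpose-inverse j k))
             ε-homo)
    where
    open IsSgn isSgn
    open MonoidMorphisms.IsMonoidHomomorphism isMonoidHomomorphism using (ε-homo)

  -- The diagonal matrix with entry ζ in position j is conjugate to s₀.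
  φ-δ : ∀ {n i} {φ : W n → Carrier} → IsSgn i φ → ∀ j → φ (window (δ j) Perm.id) ≈ ζ ^ toℕ i
  φ-δ {suc n} {i} {φ} isSgn j = begin
    φ (window (δ j) Perm.id)
      ≈⟨ φ-window-cong isSgn {π = Perm.id} {t′ ∘ₚ t}
           (λ k → sym (trans (ℕ.+-identityʳ _) (δ-transpose j k)))
           (λ k → sym (PC.transpose-inverse zero j)) ⟩
    φ (window (λ k → δ zero (t′ ⟨$⟩ʳ k) ℕ.+ 0) (t′ ∘ₚ t))
      ≈⟨ φ-window-∙ isSgn (const 0) t _ t′ ⟩
    φ (s zero j) · φ (window (λ k → δ zero (t′ ⟨$⟩ʳ k) ℕ.+ 0) (t′ ∘ₚ Perm.id))
      ≈⟨ ·-congˡ (φ-window-∙ isSgn (δ zero) Perm.id (const 0) t′) ⟩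
    φ (s zero j) · (φ (window (δ zero) Perm.id) · φ (s j zero))
      ≈⟨ ·-congˡ (·-comm _ _) ⟩
    φ (s zero j) · (φ (s j zero) · φ (window (δ zero) Perm.id))
      ≈⟨ ·-assoc _ _ _ ⟨
    (φ (s zero j) · φ (s j zero)) · φ (window (δ zero) Perm.id)
      ≈⟨ ·-cong (φ-transpose² isSgn zero j)
           (φ-cong {window (δ zero) Perm.id} {s₀} λ k l → ≈.sym (s₀≋ k l)) ⟩
    1# · φ s₀
      ≈⟨ ·-identityˡ _ ⟩
    φ s₀
      ≈⟨ φ-s₀ ⟩
    ζ ^ toℕ i ∎
    where
    open IsSgn isSgn
    open MonoidMorphisms.IsMonoidHomomorphism isMonoidHomomorphism
      using () renaming (⟦⟧-cong to φ-cong)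
    t = transpose zero j
    t′ = transpose j zero

  module _ {n : ℕ} {i : Fin r} {φ : W n → Carrier} (isSgn : IsSgn i φ) where

    open IsSgn isSgn
    open MonoidMorphisms.IsMonoidHomomorphism isMonoidHomomorphism
      using (ε-homo) renaming (⟦⟧-cong to φ-cong)

    φ-diagonal : ∀ a → φ (window a Perm.id) ≈ (ζ ^ toℕ i) ^ sum (tabulate a)
    φ-diagonal = additive≈^sum (ζ ^ toℕ i) (λ a → φ (window a Perm.id))
      (λ a≗b → φ-window-cong isSgn {π = Perm.id} {Perm.id} a≗b (λ _ → refl))
      ε-homo
      (λ a b → φ-window-∙ isSgn a Perm.id b Perm.id)
      (φ-δ isSgn)

    φ≈ : ∀ A → φ A ≈ sgn (inversions (oneLine (G.row A))) ·
                     (ζ ^ toℕ i) ^ sum (map (toℕ ∘ G.colour A) (allFin n))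
    φ≈ A = begin
      φ A
        ≈⟨ φ-cong {A} {window a π} (≋-window A) ⟩
      φ (window a π)
        -- The permutation matrix stands on the left with exponents 0, so the exponents of the
        -- product compute to `a`.
        ≈⟨ φ-window-∙ isSgn (const 0) π a Perm.id ⟩
      φ (window (const 0) π) · φ (window a Perm.id)
        ≈⟨ ·-cong (φ-permutation isSgn π) (φ-diagonal a) ⟩
      sgn (inversions (oneLine (G.row A))) · (ζ ^ toℕ i) ^ sum (tabulate a)
        ≡⟨ cong (λ l → sgn (inversions (oneLine (G.row A))) · (ζ ^ toℕ i) ^ sum l)
             (map-tabulate id a) ⟨
      sgn (inversions (oneLine (G.row A))) · (ζ ^ toℕ i) ^ sum (map a (allFin n)) ∎
      where
      a = toℕ ∘ G.colour A
      π = row-permutation A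

    sgn-RS : ∀ A → φ A ≈
      (- 1#) ^ e (𝐏 A) · (ζ ^ toℕ i) ^ sum (map (toℕ ∘ G.colour A) (allFin n))
        · sign (𝐏 A) · sign (𝐐 A)
    sgn-RS A = begin
      φ A
        ≈⟨ φ≈ A ⟩
      sgn (inversions (oneLine (G.row A))) · z
        ≡⟨ cong (λ p → sgn p · z) (inversions-oneLine-RS (G.colour A) (G.row A)
             (⟨$⟩ʳ-injective (row-permutation A))) ⟩
      sgn (parity (e (𝐏 A)) + (parity (inv (𝐏 A)) + parity (inv (𝐐 A)))) · z
        ≈⟨ ·-congʳ (≈.trans
             (sgn-+ (parity (e (𝐏 A))) (parity (inv (𝐏 A)) + parity (inv (𝐐 A))))
             (·-congˡ (sgn-+ (parity (inv (𝐏 A))) (parity (inv (𝐐 A)))))) ⟩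
      sgn (parity (e (𝐏 A))) · (sgn (parity (inv (𝐏 A))) · sgn (parity (inv (𝐐 A)))) · z
        ≈⟨ ·-congʳ (·-cong ([-1]^≈sgn (e (𝐏 A)))
             (·-cong ([-1]^≈sgn (inv (𝐏 A))) ([-1]^≈sgn (inv (𝐐 A))))) ⟨
      (- 1#) ^ e (𝐏 A) · (sign (𝐏 A) · sign (𝐐 A)) · z
        ≈⟨ ·-assoc _ _ _ ⟩
      (- 1#) ^ e (𝐏 A) · ((sign (𝐏 A) · sign (𝐐 A)) · z)
        ≈⟨ ·-congˡ (·-comm _ _) ⟩
      (- 1#) ^ e (𝐏 A) · (z · (sign (𝐏 A) · sign (𝐐 A)))
        ≈⟨ ·-assoc _ _ _ ⟨
      (- 1#) ^ e (𝐏 A) · z · (sign (𝐏 A) · sign (𝐐 A))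
        ≈⟨ ·-assoc _ _ _ ⟨
      (- 1#) ^ e (𝐏 A) · z · sign (𝐏 A) · sign (𝐐 A) ∎
      where
      z = (ζ ^ toℕ i) ^ sum (map (toℕ ∘ G.colour A) (allFin n))

-- Opened only here, since prefix +_ would make sections x +_ of parities ambiguous.
open import Data.Integer.Base using (+_)

-- The total spin and the final identity

spin-𝐏+spin-𝐐 : ∀ {r n} (a : Fin n → Fin r) (σ : Fin n → Fin n) → Injective _≡_ _≡_ σ →
  let (𝐏 , 𝐐) = windowRS a σ in
  spin 𝐏 ℚ.+ spin 𝐐 ≡ (+ sum (map (toℕ ∘ a) (allFin n))) ℚ./ 1
spin-𝐏+spin-𝐐 {r} {n} a σ σ-inj = trans
  (cong₂ (λ m m′ → ℚ.½ ℚ.* (+ m ℚ./ 1) ℚ.+ ℚ.½ ℚ.* (+ m′ ℚ./ 1))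
    (weight a σ σ-inj (proj₁ (windowRS a σ)) (size-𝐏 a σ σ-inj))
    (weight a σ σ-inj (proj₂ (windowRS a σ)) (size-𝐐 a σ σ-inj)))
  -- After factoring out the integer, `½ + ½` computes to 1.
  (trans (sym (ℚ.*-distribʳ-+ (+ m ℚ./ 1) ℚ.½ ℚ.½)) (ℚ.*-identityˡ (+ m ℚ./ 1)))
  where m = sum (map (toℕ ∘ a) (allFin n))

mainTheorem1 : ∀ {c ℓ₁ ℓ₂} (K : HeytingField c ℓ₁ ℓ₂)
    (r p n : ℕ) .{{_ : NonZero r}} .{{_ : NonZero p}} .{{_ : NonZero n}} (p∣r : p ∣ r)
    (ζ : HeytingField.Carrier K) (ζ-prim : IsPrimitiveRoot K r ζ) →
    let open ReflectionGroup K r ζ ζ-prim in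
    (w : G p n) (i : Fin r) (sgnᵢ : W n → Carrier) → IsSgn i sgnᵢ →
    let w′ = G⊆W p∣r w
        P  = 𝐏 w′
        Q  = 𝐐 w′ in
    ∃ λ (m : ℕ) →
      spin P ℚ.+ spin Q ≡ (+ m) ℚ./ 1
      × sgnᵢ w′ ≈ (- 1#) ^ e P * (ζ ^ toℕ i) ^ m * sign P * sign Q
mainTheorem1 K r p n p∣r ζ ζ-prim w i sgnᵢ isSgn =
    -- The total spin as a natural number: the sum of the exponents of `ζ` in the window of `w`.
    sum (map (toℕ ∘ G.colour w′) (allFin n))
  , spin-𝐏+spin-𝐐 (G.colour w′) (G.row w′) (⟨$⟩ʳ-injective (row-permutation w′))
  , sgn-RS isSgn w′
  where
  open ReflectionGroup K r ζ ζ-prim using (G⊆W; module G)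
  open Representation K r ζ ζ-prim
  w′ = G⊆W p∣r w
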